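{- Let $G=(V_1,E_1)$ be a connected graph with $|V_1|\ge2$ and $H=(V_2,E_2)$ a $\kappa$-regular graph on $n=|V_2|$ vertices, where $n\ge1$ and $\kappa\ge0$. Let $A_H$ be the adjacency matrix of $H$ and, for $\lambda'\in\mathbb{R}$, let \[ \psi_{H*}^{ -1}(\lambda')=\frac12\Bigl\{(n+1)\lambda'-(\kappa+2)+\sqrt{((n+1)\lambda'-(\kappa+2))^2+4(\kappa+2)\lambda'}\,\Bigr\}. \] If the following two conditions are satisfied: (i) $-2-\psi_{H*}^{ -1}(\mathrm{QEC}(G))\notin\mathrm{ev}(A_H)$; (ii) $\displaystyle -2-\min\mathrm{ev}(A_H)\le-\frac{\kappa+2}{n+1}$; then \[ \mathrm{QEC}(G\odot H)=\psi_{H*}^{ -1}(\mathrm{QEC}(G)). \]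
   Context: All graphs are finite, simple and undirected. For a connected graph $G=(V,E)$ with $|V|\ge2$ and distance matrix $D=[d(x,y)]_{x,y\in V}$ (graph distance), $\mathrm{QEC}(G)=\max\{\langle f,Df\rangle\,;\, f\in C(V),\ \langle f,f\rangle=1,\ \langle \mathbf{1},f\rangle=0\}$, where $C(V)$ is the space of real column vectors indexed by $V$ with the canonical inner product and $\mathbf{1}$ is the all-one vector. Corona: for graphs $G=(V_1,E_1)$, $H=(V_2,E_2)$ with $V_1\cap V_2=\emptyset$, $G\odot H$ is obtained from $G$ and $|V_1|$ disjoint copies of $H$ (one for each vertex of $G$) by joining each vertex of $G$ to every vertex of its copy of $H$. $\mathrm{ev}(A_H)$ denotes the set of distinct eigenvalues of $A_H$. The notation $\psi_{H*}^{ -1}$ refers to the inverse of the restriction to $(-\frac{\kappa+2}{n+1},+\infty)$ of $\psi_H(\lambda)=\frac{\lambda(\lambda+\kappa+2)}{(n+1)\lambda+\kappa+2}$; it is given explicitly by the formula in the claim. -}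

module Defs where

open import Algebra.Bundles using (CommutativeRing)
open import Data.Bool.Base using (if_then_else_)
open import Data.Fin.Base using (Fin)
import Data.Fin.Properties as Fin
open import Data.List.Base using (filter; length; tabulate)
open import Data.Nat.Base as ℕ using (ℕ; zero; suc)
import Data.Nat.Properties as ℕ
open import Data.Product.Base using (∃; ∃-syntax; _×_; _,_; proj₁; proj₂)
open import Data.Product.Function.NonDependent.Propositional using (_×-↔_)
open import Data.Sum.Base using (_⊎_; inj₁; inj₂)
open import Data.Sum.Function.Propositional using (_⊎-↔_)
open import Function.Base using (_∘_)
open import Function.Bundles using (_↔_; Inverse)
open import Function.Construct.Composition using (_↔-∘_)
open import Function.Construct.Symmetry using (↔-sym)
open import Function.Properties.Inverse using (↔⇒↣)
open import Level using (0ℓ) renaming (suc to lsuc)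
open import Relation.Binary.Core using (Rel)
open import Relation.Binary.Definitions
  using (Decidable; DecidableEquality; Irreflexive; Symmetric)
open import Relation.Binary.PropositionalEquality.Core
  using (_≡_; refl; sym; subst)
open import Relation.Binary.Structures using (IsDecTotalOrder)
open import Relation.Nullary.Decidable
  using (Dec; does; yes; no; map′; _×-dec_; via-injection)
open import Relation.Nullary.Negation using (¬_)
open import Relation.Unary as Pred using (Pred)

------------------------------------------------------------------------
-- Real numbers

-- The axioms of the classical real numbers; they determine ℝ up to
-- isomorphism.  Decidability of the order is part of the classical
-- reading.  The inverse is a total function, but nothing is said about
-- the value 0# ⁻¹.

record CompleteOrderedField ℓ : Set (lsuc ℓ) where
  infix 4 _≤_
  infix 8 _⁻¹
  infixl 7 _/_

  field
    commutativeRing : CommutativeRing ℓ ℓ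

  open CommutativeRing commutativeRing public hiding (refl; sym; trans)
  private module CR = CommutativeRing commutativeRing

  field
    0≉1             : ¬ 0# ≈ 1#
    _⁻¹             : Carrier → Carrier
    ⁻¹-inverse      : ∀ x → ¬ x ≈ 0# → x * x ⁻¹ ≈ 1#
    _≤_             : Rel Carrier ℓ
    isDecTotalOrder : IsDecTotalOrder _≈_ _≤_
    +-monoˡ-≤       : ∀ z {x y} → x ≤ y → x + z ≤ y + z
    *-nonNeg        : ∀ {x y} → 0# ≤ x → 0# ≤ y → 0# ≤ x * y

  module ≤ = IsDecTotalOrder isDecTotalOrder

  IsUpperBound : ∀ {p} → Pred Carrier p → Carrier → Set _
  IsUpperBound S b = ∀ x → S x → x ≤ b

  IsSupremum : ∀ {p} → Pred Carrier p → Carrier → Set _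
  IsSupremum S s = IsUpperBound S s × (∀ b → IsUpperBound S b → s ≤ b)

  field
    complete : (S : Pred Carrier ℓ) →
               ∃ S → ∃ (IsUpperBound S) → ∃ (IsSupremum S)

  _/_ : Carrier → Carrier → Carrier
  x / y = x * y ⁻¹

  IsMaximum : ∀ {p} → Pred Carrier p → Carrier → Set _
  IsMaximum S m = S m × (∀ x → S x → x ≤ m)

  IsMinimum : ∀ {p} → Pred Carrier p → Carrier → Set _
  IsMinimum S m = S m × (∀ x → S x → m ≤ x)

  open import Algebra.Definitions.RawMonoid +-rawMonoid public
    using () renaming (_×_ to _·_; sum to sumFin)

  fromℕ : ℕ → Carrier
  fromℕ k = k · 1#

  open import Algebra.Properties.Ring ring using (-‿distribˡ-*; -‿involutive)

  private
    ≤-respʳ : ∀ {x y z} → y ≈ z → x ≤ y → x ≤ z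
    ≤-respʳ = ≤.≤-respʳ-≈

    ≤-respˡ : ∀ {x y z} → x ≈ y → x ≤ z → y ≤ z
    ≤-respˡ = ≤.≤-respˡ-≈

    0≤1 : 0# ≤ 1#
    0≤1 with ≤.total 0# 1#
    ... | inj₁ 0≤1 = 0≤1
    ... | inj₂ 1≤0 = ≤-respʳ [-1]²≈1 (*-nonNeg 0≤-1 0≤-1)
      where
      0≤-1 : 0# ≤ - 1#
      0≤-1 = ≤-respˡ (-‿inverseʳ 1#) (≤-respʳ (+-identityˡ _) (+-monoˡ-≤ (- 1#) 1≤0))
      [-1]²≈1 : - 1# * - 1# ≈ 1#
      [-1]²≈1 = CR.trans (CR.sym (-‿distribˡ-* 1# (- 1#)))
                  (CR.trans (-‿cong (*-identityˡ (- 1#))) (-‿involutive 1#))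

    square-bound : ∀ {x y} → 0# ≤ y → x * x ≤ y → x ≤ y + 1#
    square-bound {x} {y} 0≤y x²≤y with ≤.total x 1#
    ... | inj₁ x≤1 = ≤.trans x≤1 (≤-respˡ (+-identityˡ 1#) (+-monoˡ-≤ 1# 0≤y))
    ... | inj₂ 1≤x = ≤.trans x≤x² (≤.trans x²≤y y≤y+1)
      where
      0≤x-1 : 0# ≤ x - 1#
      0≤x-1 = ≤-respˡ (-‿inverseʳ 1#) (+-monoˡ-≤ (- 1#) 1≤x)
      x≤x² : x ≤ x * x
      x≤x² = ≤-respˡ (+-identityˡ x)
        (≤-respʳ collect (+-monoˡ-≤ x (*-nonNeg 0≤x-1 (≤.trans 0≤1 1≤x))))
        where
        collect : (x - 1#) * x + x ≈ x * x
        collect = CR.trans (+-congʳ (distribʳ x x (- 1#)))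
          (CR.trans (+-assoc _ _ _)
          (CR.trans (+-congˡ (CR.trans (+-congʳ (CR.trans (CR.sym (-‿distribˡ-* 1# x))
                                                        (-‿cong (*-identityˡ x))))
                                     (-‿inverseˡ x)))
          (+-identityʳ _)))
      y≤y+1 : y ≤ y + 1#
      y≤y+1 = ≤-respˡ (+-identityˡ y) (≤-respʳ (+-comm 1# y) (+-monoˡ-≤ y 0≤1))

  -- √ y = sup {x | x² ≤ y} for 0 ≤ y, with the junk value 0 for y < 0.
  √ : Carrier → Carrier
  √ y with 0# ≤.≤? y
  ... | no  _   = 0#
  ... | yes 0≤y = proj₁ (complete (λ x → x * x ≤ y)
    (0# , ≤-respˡ (CR.sym (zeroˡ 0#)) 0≤y)
    (y + 1# , λ _ → square-bound 0≤y))

------------------------------------------------------------------------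
-- Graphs

record Graph : Set₁ where
  infix 4 _~_ _~?_
  field
    V        : Set
    ∣V∣      : ℕ
    V↔Fin    : V ↔ Fin ∣V∣
    _~_      : Rel V 0ℓ
    _~?_     : Decidable _~_
    ~-sym    : Symmetric _~_
    ~-irrefl : Irreflexive _≡_ _~_

  vertex : Fin ∣V∣ → V
  vertex = Inverse.from V↔Fin

  _≟_ : DecidableEquality V
  _≟_ = via-injection (↔⇒↣ V↔Fin) Fin._≟_

  any? : ∀ {p} {P : Pred V p} → Pred.Decidable P → Dec (∃ P)
  any? {P = P} P? = map′
    (λ (i , p) → vertex i , p)
    (λ (x , p) → Inverse.to V↔Fin x ,
                 subst P (sym (Inverse.strictlyInverseʳ V↔Fin x)) p)
    (Fin.any? (P? ∘ vertex))

  degree : V → ℕ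
  degree x = length (filter (x ~?_) (tabulate vertex))

  data Walk : ℕ → V → V → Set where
    []  : ∀ {x} → Walk zero x x
    _∷_ : ∀ {k x y z} → x ~ y → Walk k y z → Walk (suc k) x z

  Connected : Set
  Connected = ∀ x y → ∃[ k ] Walk k x y

  walk? : ∀ k x y → Dec (Walk k x y)
  walk? zero    x y = map′ (λ { refl → [] }) (λ { [] → refl }) (x ≟ y)
  walk? (suc k) x y = map′
    (λ { (_ , e , w) → e ∷ w }) (λ { (e ∷ w) → _ , e , w })
    (any? λ z → x ~? z ×-dec walk? k z y)

open Graph using (V; ∣V∣)

Regular : ℕ → Graph → Set
Regular κ G = ∀ x → Graph.degree G x ≡ κ

IsLeast : ∀ {p} → Pred ℕ p → ℕ → Set p
IsLeast P k = P k × (∀ j → P j → k ℕ.≤ j)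

least : ∀ {p} {P : Pred ℕ p} → Pred.Decidable P → ∀ k → P k → ∃ (IsLeast P)
least P? zero p = zero , p , λ _ _ → ℕ.z≤n
least {P = P} P? (suc k) p with P? zero
... | yes p₀ = zero , p₀ , λ _ _ → ℕ.z≤n
... | no ¬p₀ with least (P? ∘ suc) k p
...   | m , pm , m-least = suc m , pm , bound
  where
  bound : ∀ j → P j → suc m ℕ.≤ j
  bound zero    q with () ← ¬p₀ q
  bound (suc j) q = ℕ.s≤s (m-least j q)

distance : (G : Graph) → Graph.Connected G → (x y : V G) →
           ∃ (IsLeast (λ k → Graph.Walk G k x y))
distance G conn x y =
  let k , w = conn x y in least (λ k → Graph.walk? G k x y) k w

dist : (G : Graph) → Graph.Connected G → V G → V G → ℕ
dist G conn x y = proj₁ (distance G conn x y)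

------------------------------------------------------------------------
-- Corona

-- inj₁ x is the vertex x of G, and inj₂ (x , i) is the vertex i in the
-- copy of H attached to x.

infixl 7 _⊙_

_⊙_ : Graph → Graph → Graph
G ⊙ H = record
  { V        = G.V ⊎ (G.V × H.V)
  ; ∣V∣      = G.∣V∣ ℕ.+ G.∣V∣ ℕ.* H.∣V∣
  ; V↔Fin    = ↔-sym Fin.+↔⊎
               ↔-∘ (G.V↔Fin ⊎-↔ (↔-sym Fin.*↔× ↔-∘ (G.V↔Fin ×-↔ H.V↔Fin)))
  ; _~_      = _~_
  ; _~?_     = _~?_
  ; ~-sym    = λ {u} {v} → ~-sym u v
  ; ~-irrefl = λ { {u} refl → ~-irrefl u }
  }
  where
  module G = Graph G
  module H = Graph H

  _~_ : Rel (G.V ⊎ (G.V × H.V)) 0ℓ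
  inj₁ x       ~ inj₁ y       = x G.~ y
  inj₁ x       ~ inj₂ (y , _) = x ≡ y
  inj₂ (x , _) ~ inj₁ y       = x ≡ y
  inj₂ (x , i) ~ inj₂ (y , j) = x ≡ y × i H.~ j

  _~?_ : Decidable _~_
  inj₁ x       ~? inj₁ y       = x G.~? y
  inj₁ x       ~? inj₂ (y , _) = x G.≟ y
  inj₂ (x , _) ~? inj₁ y       = x G.≟ y
  inj₂ (x , i) ~? inj₂ (y , j) = x G.≟ y ×-dec i H.~? j

  ~-sym : ∀ u v → u ~ v → v ~ u
  ~-sym (inj₁ x)       (inj₁ y)       e       = G.~-sym e
  ~-sym (inj₁ x)       (inj₂ (y , _)) e       = sym e
  ~-sym (inj₂ (x , _)) (inj₁ y)       e       = sym e
  ~-sym (inj₂ (x , i)) (inj₂ (y , j)) (e , a) = sym e , H.~-sym a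

  ~-irrefl : ∀ u → ¬ (u ~ u)
  ~-irrefl (inj₁ x)       a       = G.~-irrefl refl a
  ~-irrefl (inj₂ (x , i)) (_ , a) = H.~-irrefl refl a

⊙-connected : ∀ G H → Graph.Connected G → Graph.Connected (G ⊙ H)
⊙-connected G H conn = joined
  where
  open Graph (G ⊙ H) using ([]; _∷_; Connected; Walk)

  lift : ∀ {k x y} → Graph.Walk G k x y → Walk k (inj₁ x) (inj₁ y)
  lift Graph.[]      = []
  lift (e Graph.∷ w) = e ∷ lift w

  _∷ʳ_ : ∀ {k u v w} → Walk k u v → Graph._~_ (G ⊙ H) v w → Walk (suc k) u w
  []      ∷ʳ a = a ∷ []
  (e ∷ w) ∷ʳ a = e ∷ (w ∷ʳ a)

  joined : Connected
  joined (inj₁ x) (inj₁ y) =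
    let k , w = conn x y in k , lift w
  joined (inj₁ x) (inj₂ (y , j)) =
    let k , w = conn x y in suc k , (lift w ∷ʳ refl)
  joined (inj₂ (x , i)) (inj₁ y) =
    let k , w = conn x y in suc k , (refl ∷ lift w)
  joined (inj₂ (x , i)) (inj₂ (y , j)) =
    let k , w = conn x y in suc (suc k) , (refl ∷ (lift w ∷ʳ refl))

------------------------------------------------------------------------
-- Linear algebra over C(V), and the quadratic embedding constant

module _ {ℓ} (ℝ : CompleteOrderedField ℓ) where
  open CompleteOrderedField ℝ

  C : Graph → Set ℓ
  C G = V G → Carrier

  Matrix : Graph → Set ℓ
  Matrix G = V G → V G → Carrier

  ∑ : (G : Graph) → C G → Carrier
  ∑ G f = sumFin (f ∘ Graph.vertex G)

  inner : (G : Graph) → C G → C G → Carrier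
  inner G f g = ∑ G λ x → f x * g x

  apply : (G : Graph) → Matrix G → C G → C G
  apply G M f x = ∑ G λ y → M x y * f y

  𝟏 : (G : Graph) → C G
  𝟏 G _ = 1#

  distanceMatrix : (G : Graph) → Graph.Connected G → Matrix G
  distanceMatrix G conn x y = fromℕ (dist G conn x y)

  adjacencyMatrix : (G : Graph) → Matrix G
  adjacencyMatrix G x y = if does (x ~? y) then 1# else 0#
    where open Graph G

  -- The maximum is taken as a relation: IsQEC G conn q says QEC(G) = q.
  IsQEC : (G : Graph) → Graph.Connected G → Pred Carrier ℓ
  IsQEC G conn = IsMaximum λ t → ∃[ f ]
    (inner G f f ≈ 1#) × (inner G (𝟏 G) f ≈ 0#) ×
    (t ≈ inner G f (apply G (distanceMatrix G conn) f))

  -- Being an eigenvalue: the set of distinct eigenvalues as a predicate.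
  ev : (G : Graph) → Matrix G → Pred Carrier ℓ
  ev G M t = ∃[ f ] (∃[ x ] ¬ f x ≈ 0#) × (∀ x → apply G M f x ≈ t * f x)

  ψ*⁻¹ : (n κ : ℕ) → Carrier → Carrier
  ψ*⁻¹ n κ t = 1# / fromℕ 2 * (b + √ (b * b + fromℕ 4 * fromℕ (κ ℕ.+ 2) * t))
    where b = fromℕ (n ℕ.+ 1) * t - fromℕ (κ ℕ.+ 2)

module Submission where

open import Defs
open import Algebra.Bundles using (CommutativeRing)
import Algebra.Solver.Ring
open import Algebra.Solver.Ring.AlmostCommutativeRing
  using (AlmostCommutativeRing; fromCommutativeRing; _-Raw-AlmostCommutative⟶_)
open import Data.Bool.Base using (if_then_else_)
open import Data.Empty using (⊥)
open import Data.Fin.Base using (Fin; zero; suc; punchIn; _↑ˡ_; _↑ʳ_; remQuot; combine)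
import Data.Fin.Properties as Fin
open import Data.Integer.Base as ℤ using (ℤ; +_; -[1+_]; _⊖_; _◃_)
import Data.Integer.Properties as ℤ
open import Data.List.Base using (filter; length; tabulate)
open import Data.Maybe.Base using (Maybe; just; nothing)
open import Data.Nat.Base as ℕ using (ℕ; zero; suc)
import Data.Nat.Properties as ℕ
open import Data.Product.Base using (∃; ∃-syntax; _×_; _,_; proj₁; proj₂)
import Data.Sign.Base as Sign
open import Data.Sum.Base using (_⊎_; inj₁; inj₂; [_,_]′)
open import Data.Vec.Functional using (Vector)
open import Function.Base using (_∘_)
open import Function.Bundles using (Inverse)
open import Relation.Binary.PropositionalEquality.Core as ≡ using (_≡_; _≢_)
open import Relation.Nullary.Decidable using (yes; no; does; dec-true; dec-false)
open import Relation.Nullary.Negation using (¬_; contradiction)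
open import Relation.Unary using (Pred)

-- Let A be the adjacency matrix of H, c = κ + 2, and Λ = ψ*⁻¹ (q) with
-- q = QEC(G): the larger root of Λ² + cΛ = q ((n+1)Λ + c).  Write a vector on
-- G ⊙ H as (f , g), with g x the restriction to the copy of H at x, and put
-- F x = f x + Σᵢ g x i.  If (f , g) has sum 0, then so does F, and
--   ⟨(f,g), D⊙ (f,g)⟩ = ⟨F, D F⟩ - Σₓ ⟨g x, (2 + A) (g x)⟩.
-- The first term is at most q ⟨F, F⟩, so the upper bound reduces to
--   q (f + Σg)² ≤ ⟨g, (2 + A) g⟩ + Λ (f² + |g|²)
-- at each vertex.  Condition (ii) and Λ ≥ - c/(n+1) make A + 2 + Λ positive
-- semidefinite; splitting off the constant part of g, an eigenvector of A,
-- leaves a 2×2 form in f and Σg that is singular because Λ is a root.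
-- Equality holds for f = (Λ + c) u and g x i = Λ u x, u a maximiser for G.

-- Condition (ii) speaks of the least element of `ev`, but the argument needs ⟨h, A h⟩ ≥ μ |h|² for
-- every h. From the field axioms alone this means producing an eigenvector at the bottom of the
-- form. Neither compactness nor a characteristic polynomial is used: completeness supplies a
-- critical shift of A, and symmetric elimination shows that a positive semidefinite form either has
-- a kernel vector or is bounded below by a positive multiple of the norm. The identity for D⊙ comes
-- from additivity: the distance of two vertices is the distance of their base points in G plus one
-- for each of them that is a leaf, except inside a single copy, where the excess is 2 + A. On
-- vectors of sum 0 the extra ones contribute nothing. The larger root enters because x² + cx -
-- q((n+1)x + c) is at most 0 both at x = q and at x = -c/(n+1). Both points therefore lie between
-- the roots, which gives q ≤ Λ for the 2×2 form and Λ ≥ -c/(n+1) for condition (ii).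

-- Ring identities with integer coefficients

module IntegerCoefficients {c ℓ} (R : CommutativeRing c ℓ) where
  open CommutativeRing R
  open import Algebra.Properties.Ring ring
  open import Algebra.Properties.AbelianGroup +-abelianGroup using (⁻¹-∙-comm)
  open import Algebra.Properties.Semiring.Mult semiring
    using (×-homo-+; ×1-homo-*) renaming (_×_ to _·_)
  open import Relation.Binary.Reasoning.Setoid setoid

  ⟦_⟧ℤ : ℤ → Carrier
  ⟦ + n ⟧ℤ      = n · 1#
  ⟦ -[1+ n ] ⟧ℤ = - (suc n · 1#)

  neg-homo : ∀ i → ⟦ ℤ.- i ⟧ℤ ≈ - ⟦ i ⟧ℤ
  neg-homo (+ zero)   = sym -0#≈0#
  neg-homo (+ suc n)  = refl
  neg-homo -[1+ n ]   = sym (-‿involutive _)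

  [x+y]-[x+z]≈y-z : ∀ x y z → (x + y) - (x + z) ≈ y - z
  [x+y]-[x+z]≈y-z x y z = begin
    (x + y) + - (x + z)     ≈⟨ +-cong (+-comm x y) (sym (⁻¹-∙-comm x z)) ⟩
    (y + x) + (- x + - z)   ≈⟨ +-assoc y x _ ⟩
    y + (x + (- x + - z))   ≈⟨ +-congˡ (sym (+-assoc x (- x) (- z))) ⟩
    y + ((x + - x) + - z)   ≈⟨ +-congˡ (+-congʳ (-‿inverseʳ x)) ⟩
    y + (0# + - z)          ≈⟨ +-congˡ (+-identityˡ (- z)) ⟩
    y - z                   ∎

  ⊖-homo : ∀ m n → ⟦ m ⊖ n ⟧ℤ ≈ m · 1# - n · 1#
  ⊖-homo m zero = begin
    m · 1#         ≈⟨ +-identityʳ _ ⟨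
    m · 1# + 0#    ≈⟨ +-congˡ -0#≈0# ⟨
    m · 1# - 0#    ∎
  ⊖-homo zero (suc n) = sym (+-identityˡ _)
  ⊖-homo (suc m) (suc n) = begin
    ⟦ suc m ⊖ suc n ⟧ℤ        ≡⟨ ≡.cong ⟦_⟧ℤ (ℤ.[1+m]⊖[1+n]≡m⊖n m n) ⟩
    ⟦ m ⊖ n ⟧ℤ                ≈⟨ ⊖-homo m n ⟩
    m · 1# - n · 1#           ≈⟨ [x+y]-[x+z]≈y-z 1# _ _ ⟨
    suc m · 1# - suc n · 1#   ∎

  +-homo : ∀ i j → ⟦ i ℤ.+ j ⟧ℤ ≈ ⟦ i ⟧ℤ + ⟦ j ⟧ℤ
  +-homo (+ m)    (+ n)    = ×-homo-+ 1# m n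
  +-homo (+ m)    -[1+ n ] = ⊖-homo m (suc n)
  +-homo -[1+ m ] (+ n)    = trans (⊖-homo n (suc m)) (+-comm _ _)
  +-homo -[1+ m ] -[1+ n ] = begin
    - (suc (suc (m ℕ.+ n)) · 1#)        ≡⟨ ≡.cong (λ k → - (k · 1#)) (ℕ.+-suc (suc m) n) ⟨
    - ((suc m ℕ.+ suc n) · 1#)          ≈⟨ -‿cong (×-homo-+ 1# (suc m) (suc n)) ⟩
    - (suc m · 1# + suc n · 1#)         ≈⟨ ⁻¹-∙-comm _ _ ⟨
    - (suc m · 1#) + - (suc n · 1#)     ∎

  +◃-homo : ∀ n → ⟦ Sign.+ ◃ n ⟧ℤ ≈ n · 1#
  +◃-homo zero    = refl
  +◃-homo (suc n) = refl

  -◃-homo : ∀ n → ⟦ Sign.- ◃ n ⟧ℤ ≈ - (n · 1#)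
  -◃-homo zero    = sym -0#≈0#
  -◃-homo (suc n) = refl

  *-homo : ∀ i j → ⟦ i ℤ.* j ⟧ℤ ≈ ⟦ i ⟧ℤ * ⟦ j ⟧ℤ
  *-homo (+ m) (+ n) = trans (+◃-homo (m ℕ.* n)) (×1-homo-* m n)
  *-homo (+ m) -[1+ n ] = begin
    ⟦ Sign.- ◃ m ℕ.* suc n ⟧ℤ   ≈⟨ -◃-homo (m ℕ.* suc n) ⟩
    - ((m ℕ.* suc n) · 1#)      ≈⟨ -‿cong (×1-homo-* m (suc n)) ⟩
    - (m · 1# * suc n · 1#)     ≈⟨ -‿distribʳ-* _ _ ⟩
    m · 1# * - (suc n · 1#)     ∎
  *-homo -[1+ m ] (+ n) = begin
    ⟦ Sign.- ◃ suc m ℕ.* n ⟧ℤ   ≈⟨ -◃-homo (suc m ℕ.* n) ⟩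
    - ((suc m ℕ.* n) · 1#)      ≈⟨ -‿cong (×1-homo-* (suc m) n) ⟩
    - (suc m · 1# * n · 1#)     ≈⟨ -‿distribˡ-* _ _ ⟩
    - (suc m · 1#) * n · 1#     ∎
  *-homo -[1+ m ] -[1+ n ] = begin
    (suc m ℕ.* suc n) · 1#              ≈⟨ ×1-homo-* (suc m) (suc n) ⟩
    suc m · 1# * suc n · 1#             ≈⟨ -‿involutive _ ⟨
    - - (suc m · 1# * suc n · 1#)       ≈⟨ -‿cong (-‿distribˡ-* _ _) ⟩
    - (- (suc m · 1#) * suc n · 1#)     ≈⟨ -‿distribʳ-* _ _ ⟩
    - (suc m · 1#) * - (suc n · 1#)     ∎

  almostCommutativeRing : AlmostCommutativeRing c ℓ
  almostCommutativeRing = fromCommutativeRing R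

  -- Cancellation in normal forms needs coefficients whose equality computes, hence integers instead
  -- of elements of the ring. With this interpretation `con (+ k)` is literally `fromℕ k`. In
  -- particular `con (+ 1)` is `1# + 0#`, so later identities that contain `1#` itself treat it as a
  -- variable `o` and remove it afterwards by an identity law.
  morphism : ℤ.+-*-rawRing -Raw-AlmostCommutative⟶ almostCommutativeRing
  morphism = record
    { ⟦_⟧    = ⟦_⟧ℤ
    ; +-homo = +-homo
    ; *-homo = *-homo
    ; -‿homo = neg-homo
    ; 0-homo = refl
    ; 1-homo = +-identityʳ 1#
    }

  ≟-coefficients : ∀ i j → Maybe (⟦ i ⟧ℤ ≈ ⟦ j ⟧ℤ)
  ≟-coefficients i j with i ℤ.≟ j
  ... | yes ≡.refl = just refl
  ... | no _       = nothing

  open Algebra.Solver.Ring ℤ.+-*-rawRing almostCommutativeRing morphism ≟-coefficients public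
    using (solve; _:=_; _:+_; _:*_; _:-_; :-_; con)

-- Ordered-field inequalities and the square root

module OrderedField {ℓ} (ℝ : CompleteOrderedField ℓ) where
  open CompleteOrderedField ℝ public hiding (zero)
  open CommutativeRing commutativeRing public using (refl; sym; trans)
  open IntegerCoefficients commutativeRing public using (solve; _:=_; _:+_; _:*_; _:-_; :-_; con)
  open import Relation.Binary.Reasoning.Setoid setoid

  infix 4 _<_
  _<_ : Carrier → Carrier → Set ℓ
  x < y = ¬ (y ≤ x)

  <⇒≤ : ∀ {x y} → x < y → x ≤ y
  <⇒≤ {x} {y} x<y with ≤.total x y
  ... | inj₁ x≤y = x≤y
  ... | inj₂ y≤x = contradiction y≤x x<y

  <⇒≉ : ∀ {x y} → x < y → ¬ y ≈ x
  <⇒≉ x<y y≈x = x<y (≤.reflexive y≈x)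

  ≮⇒≥ : ∀ {x y} → ¬ x < y → y ≤ x
  ≮⇒≥ {x} {y} x≮y with y ≤.≤? x
  ... | yes y≤x = y≤x
  ... | no  y≰x = contradiction y≰x x≮y

  nonNeg⇒≤ : ∀ {x y} → 0# ≤ y - x → x ≤ y
  nonNeg⇒≤ {x} {y} p =
    ≤.≤-respˡ-≈ (+-identityˡ x)
      (≤.≤-respʳ-≈ (solve 2 (λ x y → y :- x :+ x := y) refl x y) (+-monoˡ-≤ x p))

  ≤⇒nonNeg : ∀ {x y} → x ≤ y → 0# ≤ y - x
  ≤⇒nonNeg {x} p = ≤.≤-respˡ-≈ (-‿inverseʳ x) (+-monoˡ-≤ (- x) p)

  nonNeg-resp : ∀ {x y} → x ≈ y → 0# ≤ x → 0# ≤ y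
  nonNeg-resp = ≤.≤-respʳ-≈

  +-nonNeg : ∀ {x y} → 0# ≤ x → 0# ≤ y → 0# ≤ x + y
  +-nonNeg {x} {y} p q =
    ≤.trans q (≤.≤-respˡ-≈ (+-identityˡ y) (+-monoˡ-≤ y p))

  x≤0⇒0≤-x : ∀ {x} → x ≤ 0# → 0# ≤ - x
  x≤0⇒0≤-x p = nonNeg-resp (+-identityˡ _) (≤⇒nonNeg p)

  square-nonNeg : ∀ x → 0# ≤ x * x
  square-nonNeg x with ≤.total 0# x
  ... | inj₁ p = *-nonNeg p p
  ... | inj₂ p = nonNeg-resp (solve 1 (λ x → :- x :* :- x := x :* x) refl x)
                   (*-nonNeg (x≤0⇒0≤-x p) (x≤0⇒0≤-x p))

  0≤1 : 0# ≤ 1#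
  0≤1 = nonNeg-resp (*-identityˡ 1#) (square-nonNeg 1#)

  0<1 : 0# < 1#
  0<1 p = 0≉1 (≤.antisym 0≤1 p)

  fromℕ-nonNeg : ∀ n → 0# ≤ fromℕ n
  fromℕ-nonNeg zero    = ≤.refl
  fromℕ-nonNeg (suc n) = +-nonNeg 0≤1 (fromℕ-nonNeg n)

  +-pos : ∀ {x y} → 0# < x → 0# ≤ y → 0# < x + y
  +-pos {x} {y} 0<x 0≤y x+y≤0 = 0<x (≤.trans x≤x+y x+y≤0)
    where
    x≤x+y : x ≤ x + y
    x≤x+y = nonNeg⇒≤ (nonNeg-resp (solve 2 (λ x y → y := x :+ y :- x) refl x y) 0≤y)

  fromℕ-pos : ∀ n → 0# < fromℕ (suc n)
  fromℕ-pos n = +-pos 0<1 (fromℕ-nonNeg n)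

  nonNeg-+≈0 : ∀ {x y} → 0# ≤ x → 0# ≤ y → x + y ≈ 0# → x ≈ 0#
  nonNeg-+≈0 {x} {y} 0≤x 0≤y x+y≈0 with x ≤.≤? 0#
  ... | yes x≤0 = ≤.antisym x≤0 0≤x
  ... | no  0<x = contradiction (≤.reflexive x+y≈0) (+-pos 0<x 0≤y)

  *-cancelˡ-≈0 : ∀ {a x} → ¬ a ≈ 0# → a * x ≈ 0# → x ≈ 0#
  *-cancelˡ-≈0 {a} {x} a≉0 ax≈0 = begin
    x               ≈⟨ *-identityˡ x ⟨
    1# * x          ≈⟨ *-congʳ (⁻¹-inverse a a≉0) ⟨
    a * a ⁻¹ * x    ≈⟨ solve 3 (λ a i x → a :* i :* x := i :* (a :* x)) refl a (a ⁻¹) x ⟩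
    a ⁻¹ * (a * x)  ≈⟨ *-congˡ ax≈0 ⟩
    a ⁻¹ * 0#       ≈⟨ zeroʳ _ ⟩
    0#              ∎

  square≈0 : ∀ {x} → x * x ≈ 0# → x ≈ 0#
  square≈0 {x} xx≈0 with x ≤.≟ 0#
  ... | yes x≈0 = x≈0
  ... | no  x≉0 = *-cancelˡ-≈0 x≉0 xx≈0

  -- If x ≤ 0, then ax and a(-x) are both nonnegative with sum 0, so both vanish and x = 0. Later
  -- proofs use this to clear positive factors instead of dividing.
  *-cancelˡ-nonNeg : ∀ {a x} → 0# < a → 0# ≤ a * x → 0# ≤ x
  *-cancelˡ-nonNeg {a} {x} 0<a 0≤ax with ≤.total 0# x
  ... | inj₁ 0≤x = 0≤x
  ... | inj₂ x≤0 = ≤.reflexive (sym (*-cancelˡ-≈0 (<⇒≉ 0<a)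
      (nonNeg-+≈0 0≤ax (*-nonNeg (<⇒≤ 0<a) (x≤0⇒0≤-x x≤0))
        (solve 2 (λ a x → a :* x :+ a :* :- x := con (+ 0)) refl a x))))

  ⁻¹-nonNeg : ∀ {a} → 0# < a → 0# ≤ a ⁻¹
  ⁻¹-nonNeg {a} 0<a = *-cancelˡ-nonNeg 0<a
    (nonNeg-resp (sym (⁻¹-inverse a (<⇒≉ 0<a))) 0≤1)

  *-pos : ∀ {x y} → 0# < x → 0# < y → 0# < x * y
  *-pos {x} {y} 0<x 0<y xy≤0 = <⇒≉ 0<y (*-cancelˡ-≈0 (<⇒≉ 0<x)
    (≤.antisym xy≤0 (*-nonNeg (<⇒≤ 0<x) (<⇒≤ 0<y))))

  ⁻¹-pos : ∀ {a} → 0# < a → 0# < a ⁻¹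
  ⁻¹-pos {a} 0<a a⁻¹≤0 = 0<1 (≤.reflexive (begin
    1#        ≈⟨ ⁻¹-inverse a (<⇒≉ 0<a) ⟨
    a * a ⁻¹  ≈⟨ *-congˡ (≤.antisym a⁻¹≤0 (⁻¹-nonNeg 0<a)) ⟩
    a * 0#    ≈⟨ zeroʳ a ⟩
    0#        ∎))

  square-cancel-≤ : ∀ {x y} → 0# ≤ y → x * x ≤ y * y → x ≤ y
  square-cancel-≤ {x} {y} 0≤y xx≤yy with x ≤.≤? y
  ... | yes x≤y = x≤y
  ... | no  y<x = contradiction xx-yy≤0 (*-pos 0<x-y (+-pos 0<x 0≤y))
    where
    0<x-y : 0# < x - y
    0<x-y x-y≤0 = y<x (nonNeg⇒≤ (nonNeg-resp
      (solve 2 (λ x y → :- (x :- y) := y :- x) refl x y) (x≤0⇒0≤-x x-y≤0)))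
    0<x : 0# < x
    0<x x≤0 = y<x (≤.trans x≤0 0≤y)
    xx-yy≤0 : (x - y) * (x + y) ≤ 0#
    xx-yy≤0 = nonNeg⇒≤ (nonNeg-resp
      (solve 2 (λ x y → y :* y :- x :* x := con (+ 0) :- (x :- y) :* (x :+ y)) refl x y)
      (≤⇒nonNeg xx≤yy))

  supremum-square : ∀ {y s} → 0# ≤ y → IsSupremum (λ x → x * x ≤ y) s →
                    0# ≤ s × s * s ≈ y
  supremum-square {y} {s} 0≤y (upper , least) = 0≤s , ≤.antisym ss≤y y≤ss
    where
    0≤s : 0# ≤ s
    0≤s = upper 0# (≤.≤-respˡ-≈ (sym (zeroˡ 0#)) 0≤y)

    y≤ss : y ≤ s * s
    y≤ss = ≮⇒≥ λ ss<y → 0<δ ss<y (δ≤0 ss<y)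
      where
      e = y - s * s
      -- With this k the relation kδ = e gives y - (s + δ)² = δ(1 + (e - δ)), and δ ≤ e because k ≥
      -- 1. So s + δ still belongs to the set, against s being an upper bound.
      k = 1# + (s + s + e)
      δ = e * k ⁻¹
      module _ (ss<y : s * s < y) where
        0≤e : 0# ≤ e
        0≤e = ≤⇒nonNeg (<⇒≤ ss<y)
        0<e : 0# < e
        0<e e≤0 = ss<y (nonNeg⇒≤ (nonNeg-resp
          (solve 2 (λ y s → :- (y :- s) := s :- y) refl y (s * s)) (x≤0⇒0≤-x e≤0)))
        0≤k-1 : 0# ≤ s + s + e
        0≤k-1 = +-nonNeg (+-nonNeg 0≤s 0≤s) 0≤e
        0<k : 0# < k
        0<k = +-pos 0<1 0≤k-1
        0<δ : 0# < δ
        0<δ = *-pos 0<e (⁻¹-pos 0<k)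
        kδ≈e : k * δ ≈ e
        kδ≈e = begin
          k * (e * k ⁻¹)  ≈⟨ solve 3 (λ k e i → k :* (e :* i) := e :* (k :* i)) refl k e (k ⁻¹) ⟩
          e * (k * k ⁻¹)  ≈⟨ *-congˡ (⁻¹-inverse k (<⇒≉ 0<k)) ⟩
          e * 1#          ≈⟨ *-identityʳ e ⟩
          e               ∎
        0≤e-δ : 0# ≤ e - δ
        0≤e-δ = nonNeg-resp (begin
          (s + s + e) * δ    ≈⟨ solve 2 (λ r d → r :* d := (con (+ 1) :+ r) :* d :- d) refl (s + s + e) δ ⟩
          (1 · 1# + (s + s + e)) * δ - δ ≈⟨ +-congʳ (*-congʳ (+-congʳ (+-identityʳ 1#))) ⟩
          k * δ - δ          ≈⟨ +-congʳ kδ≈e ⟩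
          e - δ              ∎) (*-nonNeg 0≤k-1 (<⇒≤ 0<δ))
        [s+δ]²≤y : (s + δ) * (s + δ) ≤ y
        [s+δ]²≤y = nonNeg⇒≤ (nonNeg-resp (begin
          δ * (1# + (e - δ))
            ≈⟨ solve 4 (λ s e d o → d :* (o :+ (e :- d))
                 := (o :+ (s :+ s :+ e)) :* d :+ s :* s :- (s :+ d) :* (s :+ d)) refl s e δ 1# ⟩
          k * δ + s * s - (s + δ) * (s + δ)
            ≈⟨ +-congʳ (+-congʳ kδ≈e) ⟩
          e + s * s - (s + δ) * (s + δ)
            ≈⟨ +-congʳ (solve 2 (λ y t → y :- t :+ t := y) refl y (s * s)) ⟩
          y - (s + δ) * (s + δ) ∎) (*-nonNeg (<⇒≤ 0<δ) (+-nonNeg 0≤1 0≤e-δ)))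
        δ≤0 : δ ≤ 0#
        δ≤0 = nonNeg⇒≤ (nonNeg-resp
          (solve 2 (λ s d → s :- (s :+ d) := con (+ 0) :- d) refl s δ)
          (≤⇒nonNeg (upper (s + δ) [s+δ]²≤y)))

    ss≤y : s * s ≤ y
    ss≤y = ≮⇒≥ λ y<ss → 0<δ y<ss (δ≤0 y<ss)
      where
      e = s * s - y
      -- A Newton step for x² = y: (s - δ)² = y + δ² ≥ y, so s - δ is a smaller upper bound.
      δ = e * (s + s) ⁻¹
      module _ (y<ss : y < s * s) where
        0<e : 0# < e
        0<e e≤0 = y<ss (nonNeg⇒≤ (nonNeg-resp
          (solve 2 (λ y s → :- (s :- y) := y :- s) refl y (s * s)) (x≤0⇒0≤-x e≤0)))
        0<s : 0# < s
        0<s s≤0 = y<ss (≤.≤-respˡ-≈ (trans (sym (zeroˡ s))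
          (*-congʳ (≤.antisym 0≤s s≤0))) 0≤y)
        0<s+s : 0# < s + s
        0<s+s = +-pos 0<s 0≤s
        0<δ : 0# < δ
        0<δ = *-pos 0<e (⁻¹-pos 0<s+s)
        [s+s]δ≈e : (s + s) * δ ≈ e
        [s+s]δ≈e = begin
          (s + s) * (e * (s + s) ⁻¹)  ≈⟨ solve 3 (λ k e i → k :* (e :* i) := e :* (k :* i)) refl (s + s) e ((s + s) ⁻¹) ⟩
          e * ((s + s) * (s + s) ⁻¹)  ≈⟨ *-congˡ (⁻¹-inverse _ (<⇒≉ 0<s+s)) ⟩
          e * 1#                      ≈⟨ *-identityʳ e ⟩
          e                           ∎
        0≤s-δ : 0# ≤ s - δ
        0≤s-δ = *-cancelˡ-nonNeg 0<s+s (nonNeg-resp (begin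
          s * s + y                    ≈⟨ solve 2 (λ s y → s :* s :+ y := (s :+ s) :* s :- (s :* s :- y)) refl s y ⟩
          (s + s) * s - e              ≈⟨ +-congˡ (-‿cong [s+s]δ≈e) ⟨
          (s + s) * s - (s + s) * δ    ≈⟨ solve 2 (λ s d → (s :+ s) :* s :- (s :+ s) :* d := (s :+ s) :* (s :- d)) refl s δ ⟩
          (s + s) * (s - δ)            ∎) (+-nonNeg (square-nonNeg s) 0≤y))
        y≤[s-δ]² : y ≤ (s - δ) * (s - δ)
        y≤[s-δ]² = nonNeg⇒≤ (nonNeg-resp (begin
          δ * δ
            ≈⟨ solve 3 (λ s d y → d :* d := (s :- d) :* (s :- d) :- (y :+ (s :* s :- y :- (s :+ s) :* d))) refl s δ y ⟩
          (s - δ) * (s - δ) - (y + (e - (s + s) * δ))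
            ≈⟨ +-congˡ (-‿cong (+-congˡ (trans (+-congˡ (-‿cong [s+s]δ≈e)) (-‿inverseʳ e)))) ⟩
          (s - δ) * (s - δ) - (y + 0#)
            ≈⟨ +-congˡ (-‿cong (+-identityʳ y)) ⟩
          (s - δ) * (s - δ) - y ∎) (square-nonNeg δ))
        δ≤0 : δ ≤ 0#
        δ≤0 = nonNeg⇒≤ (nonNeg-resp
          (solve 2 (λ s d → s :- d :- s := con (+ 0) :- d) refl s δ)
          (≤⇒nonNeg (least (s - δ) λ x xx≤y →
            square-cancel-≤ 0≤s-δ (≤.trans xx≤y y≤[s-δ]²))))

  √-nonNeg×square : ∀ {y} → 0# ≤ y → 0# ≤ √ y × √ y * √ y ≈ y
  √-nonNeg×square {y} 0≤y with 0# ≤.≤? y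
  ... | no  0≰y  = contradiction 0≤y 0≰y
  ... | yes 0≤y′ = supremum-square 0≤y′ (proj₂ (complete _ _ _))

-- Finite sums and their order properties

module FiniteSums {ℓ} (ℝ : CompleteOrderedField ℓ) where
  open OrderedField ℝ public
  open import Algebra.Properties.Semiring.Sum semiring public
    using (*-distribˡ-sum; *-distribʳ-sum; ∑-distrib-+; ∑-comm; sum-remove; sum-replicate-zero)
  open import Relation.Binary.Reasoning.Setoid setoid

  sum-cong : ∀ {n} {u v : Vector Carrier n} → (∀ i → u i ≈ v i) → sumFin u ≈ sumFin v
  sum-cong {zero}  u≈v = refl
  sum-cong {suc n} u≈v = +-cong (u≈v zero) (sum-cong (u≈v ∘ suc))

  sum-nonNeg : ∀ {n} {v : Vector Carrier n} → (∀ i → 0# ≤ v i) → 0# ≤ sumFin v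
  sum-nonNeg {zero}  0≤v = ≤.refl
  sum-nonNeg {suc n} 0≤v = +-nonNeg (0≤v zero) (sum-nonNeg (0≤v ∘ suc))

  sum-≈0 : ∀ {n} {v : Vector Carrier n} → (∀ i → v i ≈ 0#) → sumFin v ≈ 0#
  sum-≈0 {n} v≈0 = trans (sum-cong v≈0) (sum-replicate-zero n)

  sum-single : ∀ {n} (v : Vector Carrier n) i → (∀ j → j ≢ i → v j ≈ 0#) → sumFin v ≈ v i
  sum-single {suc n} v i v≈0 = begin
    sumFin v                        ≈⟨ sum-remove {i = i} v ⟩
    v i + sumFin (v ∘ punchIn i)    ≈⟨ +-congˡ (sum-≈0 λ j → v≈0 _ (Fin.punchInᵢ≢i i j)) ⟩
    v i + 0#                        ≈⟨ +-identityʳ _ ⟩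
    v i                             ∎

  sum-neg : ∀ {n} (v : Vector Carrier n) → sumFin (λ i → - v i) ≈ - sumFin v
  sum-neg v = begin
    sumFin (λ i → - v i)            ≈⟨ sum-cong (λ i → solve 1 (λ x → :- x := :- con (+ 1) :* x) refl (v i)) ⟩
    sumFin (λ i → - (1 · 1#) * v i) ≈⟨ *-distribˡ-sum _ v ⟨
    - (1 · 1#) * sumFin v           ≈⟨ solve 1 (λ x → :- con (+ 1) :* x := :- x) refl (sumFin v) ⟩
    - sumFin v                      ∎

  sum-mono : ∀ {n} {u v : Vector Carrier n} → (∀ i → u i ≤ v i) → sumFin u ≤ sumFin v
  sum-mono {u = u} {v} u≤v = nonNeg⇒≤ (nonNeg-resp
    (trans (∑-distrib-+ v _) (+-congˡ (sum-neg u))) (sum-nonNeg (≤⇒nonNeg ∘ u≤v)))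

  sum-const : ∀ n x → sumFin {n} (λ _ → x) ≈ fromℕ n * x
  sum-const zero    x = sym (zeroˡ x)
  sum-const (suc n) x = trans (+-congˡ (sum-const n x))
    (trans (+-congʳ (sym (*-identityˡ x))) (sym (distribʳ x 1# (fromℕ n))))

  sum-nonNeg-≈0 : ∀ {n} {v : Vector Carrier n} → (∀ i → 0# ≤ v i) → sumFin v ≈ 0# →
                  ∀ i → v i ≈ 0#
  sum-nonNeg-≈0 {suc n} 0≤v s zero = nonNeg-+≈0 (0≤v zero) (sum-nonNeg (0≤v ∘ suc)) s
  sum-nonNeg-≈0 {suc n} 0≤v s (suc i) = sum-nonNeg-≈0 (0≤v ∘ suc)
    (nonNeg-+≈0 (sum-nonNeg (0≤v ∘ suc)) (0≤v zero) (trans (+-comm _ _) s)) i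

-- Positive semidefinite matrices and the least eigenvalue

module SymmetricMatrices {ℓ} (ℝ : CompleteOrderedField ℓ) where
  open FiniteSums ℝ
  open import Data.Vec.Functional using (_∷_)
  open import Relation.Binary.Reasoning.Setoid setoid

  infix 7 _∙_
  _∙_ : ∀ {n} → Vector Carrier n → Vector Carrier n → Carrier
  u ∙ v = sumFin λ i → u i * v i

  SquareMatrix : ℕ → Set ℓ
  SquareMatrix n = Fin n → Fin n → Carrier

  IsSymmetric : ∀ {n} → SquareMatrix n → Set ℓ
  IsSymmetric A = ∀ i j → A i j ≈ A j i

  quad : ∀ {n} → SquareMatrix n → Vector Carrier n → Carrier
  quad A v = v ∙ (λ i → A i ∙ v)

  PosSemidef : ∀ {n} → SquareMatrix n → Set ℓ
  PosSemidef A = ∀ v → 0# ≤ quad A v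

  IsKernelVector : ∀ {n} → SquareMatrix n → Vector Carrier n → Set ℓ
  IsKernelVector A v = (∃[ i ] ¬ v i ≈ 0#) × (∀ i → A i ∙ v ≈ 0#)

  norm²-nonNeg : ∀ {n} (v : Vector Carrier n) → 0# ≤ v ∙ v
  norm²-nonNeg v = sum-nonNeg (λ i → square-nonNeg (v i))

  ∙-comm : ∀ {n} (u v : Vector Carrier n) → u ∙ v ≈ v ∙ u
  ∙-comm u v = sum-cong (λ i → *-comm (u i) (v i))

  ∙-distribˡ-+ : ∀ {n} (u v w : Vector Carrier n) → u ∙ (λ i → v i + w i) ≈ u ∙ v + u ∙ w
  ∙-distribˡ-+ u v w = trans (sum-cong λ i → distribˡ (u i) (v i) (w i)) (∑-distrib-+ (λ i → u i * v i) (λ i → u i * w i))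

  ∙-scaleʳ : ∀ {n} c (u v : Vector Carrier n) → u ∙ (λ i → c * v i) ≈ c * (u ∙ v)
  ∙-scaleʳ c u v = trans
    (sum-cong λ i → solve 3 (λ c x y → x :* (c :* y) := c :* (x :* y)) refl c (u i) (v i))
    (sym (*-distribˡ-sum c (λ i → u i * v i)))

  -- A crude Cauchy-Schwarz inequality. Any finite constant will do, so the induction uses (bx + p)²
  -- ≤ 2b²x² + 2p², whose defect is (bx - p)².
  linear-form-bounded : ∀ {n} (β : Vector Carrier n) →
    ∃[ K ] 0# ≤ K × (∀ v → (β ∙ v) * (β ∙ v) ≤ K * (v ∙ v))
  linear-form-bounded {zero} β = 0# , ≤.refl , λ v →
    ≤.reflexive (solve 0 (con (+ 0) :* con (+ 0) := con (+ 0) :* con (+ 0)) refl)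
  linear-form-bounded {suc n} β with linear-form-bounded (β ∘ suc)
  ... | K , 0≤K , bound = b * b + b * b + (K + K)
    , +-nonNeg (+-nonNeg (square-nonNeg b) (square-nonNeg b)) (+-nonNeg 0≤K 0≤K)
    , λ v → nonNeg⇒≤ (nonNeg-resp
        (solve 5 (λ b x p K s →
            (b :* x :- p) :* (b :* x :- p) :+ ((K :* s :- p :* p) :+ (K :* s :- p :* p))
              :+ ((b :* b :+ b :* b) :* s :+ (K :+ K) :* (x :* x))
            := (b :* b :+ b :* b :+ (K :+ K)) :* (x :* x :+ s)
              :- (b :* x :+ p) :* (b :* x :+ p)) refl
          b (v zero) ((β ∘ suc) ∙ (v ∘ suc)) K ((v ∘ suc) ∙ (v ∘ suc)))
        (+-nonNeg
          (+-nonNeg (square-nonNeg _)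
            (let d = ≤⇒nonNeg (bound (v ∘ suc)) in +-nonNeg d d))
          (+-nonNeg
            (*-nonNeg (+-nonNeg (square-nonNeg b) (square-nonNeg b)) (norm²-nonNeg (v ∘ suc)))
            (*-nonNeg (+-nonNeg 0≤K 0≤K) (square-nonNeg (v zero))))))
    where b = β zero

  module Block {n} (B : SquareMatrix (suc n)) (B-sym : IsSymmetric B) where
    a : Carrier
    a = B zero zero

    b : Vector Carrier n
    b j = B zero (suc j)

    D : SquareMatrix n
    D i j = B (suc i) (suc j)

    quad-block : ∀ v → let x = v zero; w = v ∘ suc in
      quad B v ≈ a * (x * x) + (x * (b ∙ w) + x * (b ∙ w)) + quad D w
    quad-block v = begin
      x * (a * x + b ∙ w) + w ∙ (λ i → B (suc i) zero * x + D i ∙ w)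
        ≈⟨ +-congˡ (∙-distribˡ-+ w _ _) ⟩
      x * (a * x + b ∙ w) + (w ∙ (λ i → B (suc i) zero * x) + quad D w)
        ≈⟨ +-congˡ (+-congʳ (trans
             (sum-cong λ i → *-congˡ (trans (*-comm _ x) (*-congˡ (B-sym (suc i) zero))))
             (trans (∙-scaleʳ x w b) (*-congˡ (∙-comm w b))))) ⟩
      x * (a * x + b ∙ w) + (x * (b ∙ w) + quad D w)
        ≈⟨ solve 4 (λ x a β q → x :* (a :* x :+ β) :+ (x :* β :+ q)
             := a :* (x :* x) :+ (x :* β :+ x :* β) :+ q) refl x a (b ∙ w) (quad D w) ⟩
      a * (x * x) + (x * (b ∙ w) + x * (b ∙ w)) + quad D w ∎
      where
      x = v zero
      w = v ∘ suc

    0≤a : PosSemidef B → 0# ≤ a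
    0≤a psd = nonNeg-resp (begin
      quad B e₀
        ≈⟨ quad-block e₀ ⟩
      a * (1# * 1#) + (1# * (b ∙ 𝟎) + 1# * (b ∙ 𝟎)) + quad D 𝟎
        ≈⟨ +-cong (+-cong (trans (*-congˡ (*-identityˡ 1#)) (*-identityʳ a))
             (trans (+-cong 1*b∙𝟎≈0 1*b∙𝟎≈0) (+-identityˡ 0#)))
             (sum-≈0 {n} λ i → zeroˡ (D i ∙ 𝟎)) ⟩
      a + 0# + 0#
        ≈⟨ trans (+-identityʳ _) (+-identityʳ a) ⟩
      a ∎) (psd e₀)
      where
      𝟎 : Vector Carrier n
      𝟎 _ = 0#
      e₀ : Vector Carrier (suc n)
      e₀ = 1# ∷ 𝟎
      1*b∙𝟎≈0 : 1# * (b ∙ 𝟎) ≈ 0#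
      1*b∙𝟎≈0 = trans (*-identityˡ _) (sum-≈0 λ i → zeroʳ (b i))

    -- With a zero pivot the form at (x, b) is 2x|b|² + k with k = ⟨b, D b⟩, which is affine in x
    -- and so cannot stay nonnegative unless |b|² = 0. The choice x = -(k + 1)/|b|² makes its value
    -- -(k + 2), negative since k ≥ 0.
    a≈0⇒b≈0 : PosSemidef B → a ≈ 0# → ∀ i → b i ≈ 0#
    a≈0⇒b≈0 psd a≈0 i = square≈0 (sum-nonNeg-≈0 (λ j → square-nonNeg (b j)) r≈0 i)
      where
      r = b ∙ b
      k = quad D b
      2xr+k-nonNeg : ∀ x → 0# ≤ x * r + x * r + k
      2xr+k-nonNeg x = nonNeg-resp (begin
        quad B (x ∷ b)
          ≈⟨ quad-block (x ∷ b) ⟩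
        a * (x * x) + (x * r + x * r) + k
          ≈⟨ +-congʳ (+-congʳ (trans (*-congʳ a≈0) (zeroˡ _))) ⟩
        0# + (x * r + x * r) + k
          ≈⟨ +-congʳ (+-identityˡ _) ⟩
        x * r + x * r + k ∎) (psd (x ∷ b))
      0≤k : 0# ≤ k
      0≤k = nonNeg-resp (solve 2 (λ r k → con (+ 0) :* r :+ con (+ 0) :* r :+ k := k) refl r k)
        (2xr+k-nonNeg 0#)
      r≈0 : r ≈ 0#
      r≈0 with r ≤.≟ 0#
      ... | yes r≈0 = r≈0
      ... | no  r≉0 = contradiction (nonNeg⇒≤ (nonNeg-resp (begin
              x * r + x * r + k
                ≈⟨ solve 4 (λ r i k o → (:- (k :+ o) :* i) :* r :+ (:- (k :+ o) :* i) :* r :+ k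
                     := k :- ((k :+ o) :* (r :* i) :+ (k :+ o) :* (r :* i))) refl r (r ⁻¹) k 1# ⟩
              k - ((k + 1#) * (r * r ⁻¹) + (k + 1#) * (r * r ⁻¹))
                ≈⟨ +-congˡ (-‿cong (+-cong (*-congˡ rr⁻¹≈1) (*-congˡ rr⁻¹≈1))) ⟩
              k - ((k + 1#) * 1# + (k + 1#) * 1#)
                ≈⟨ +-congˡ (-‿cong (+-cong (*-identityʳ _) (*-identityʳ _))) ⟩
              k - ((k + 1#) + (k + 1#))
                ≈⟨ solve 2 (λ k o → k :- ((k :+ o) :+ (k :+ o)) := con (+ 0) :- (o :+ (o :+ k))) refl k 1# ⟩
              0# - (1# + (1# + k)) ∎) (2xr+k-nonNeg x)))
            (+-pos 0<1 (+-nonNeg 0≤1 0≤k))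
        where
        x = - (k + 1#) * r ⁻¹
        rr⁻¹≈1 = ⁻¹-inverse r r≉0

    kernel-of-zero-row : a ≈ 0# → (∀ i → b i ≈ 0#) → ∃ (IsKernelVector B)
    kernel-of-zero-row a≈0 b≈0 = (1# ∷ λ _ → 0#) , (zero , λ 1≈0 → 0≉1 (sym 1≈0)) , λ i →
      trans (+-cong (trans (*-identityʳ _) (column≈0 i)) (sum-≈0 {n} λ j → zeroʳ (B i (suc j))))
        (+-identityˡ 0#)
      where
      column≈0 : ∀ i → B i zero ≈ 0#
      column≈0 zero    = a≈0
      column≈0 (suc i) = trans (B-sym (suc i) zero) (b≈0 i)

    -- One step of symmetric elimination with pivot a: `S` is the Schur complement D - b bᵀ/a, and
    -- `β` is the row b/a that completes the square in the first coordinate.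
    module Schur (0<a : 0# < a) where
      aa⁻¹≈1 : a * a ⁻¹ ≈ 1#
      aa⁻¹≈1 = ⁻¹-inverse a (<⇒≉ 0<a)

      β : Vector Carrier n
      β j = a ⁻¹ * b j

      S : SquareMatrix n
      S i j = D i j + - b i * β j

      S-sym : IsSymmetric S
      S-sym i j = +-cong (B-sym (suc i) (suc j))
        (solve 3 (λ t x y → :- x :* (t :* y) := :- y :* (t :* x)) refl (a ⁻¹) (b i) (b j))

      aβ≈b : ∀ w → a * (β ∙ w) ≈ b ∙ w
      aβ≈b w = begin
        a * (β ∙ w)               ≈⟨ *-distribˡ-sum a (λ i → β i * w i) ⟩
        sumFin (λ i → a * (a ⁻¹ * b i * w i))
          ≈⟨ sum-cong (λ i → trans
               (solve 4 (λ a t x y → a :* (t :* x :* y) := a :* t :* (x :* y)) refl a (a ⁻¹) (b i) (w i))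
               (trans (*-congʳ aa⁻¹≈1) (*-identityˡ _))) ⟩
        b ∙ w                     ∎

      S-row : ∀ w i → S i ∙ w ≈ D i ∙ w - b i * (β ∙ w)
      S-row w i = begin
        sumFin (λ j → (D i j + - b i * β j) * w j)
          ≈⟨ sum-cong (λ j → solve 4 (λ d x y w → (d :+ :- x :* y) :* w := d :* w :+ :- x :* (y :* w))
               refl (D i j) (b i) (β j) (w j)) ⟩
        sumFin (λ j → D i j * w j + - b i * (β j * w j))
          ≈⟨ ∑-distrib-+ (λ j → D i j * w j) _ ⟩
        D i ∙ w + sumFin (λ j → - b i * (β j * w j))
          ≈⟨ +-congˡ (*-distribˡ-sum (- b i) (λ j → β j * w j)) ⟨
        D i ∙ w + - b i * (β ∙ w)
          ≈⟨ solve 3 (λ d x y → d :+ :- x :* y := d :- x :* y) refl (D i ∙ w) (b i) (β ∙ w) ⟩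
        D i ∙ w - b i * (β ∙ w) ∎

      quad-S : ∀ w → quad S w ≈ quad D w - a * ((β ∙ w) * (β ∙ w))
      quad-S w = begin
        w ∙ (λ i → S i ∙ w)
          ≈⟨ sum-cong (λ i → *-congˡ (trans (S-row w i)
               (+-congˡ (solve 2 (λ x y → :- (x :* y) := :- y :* x) refl (b i) (β ∙ w))))) ⟩
        w ∙ (λ i → D i ∙ w + - (β ∙ w) * b i)
          ≈⟨ ∙-distribˡ-+ w _ _ ⟩
        quad D w + w ∙ (λ i → - (β ∙ w) * b i)
          ≈⟨ +-congˡ (∙-scaleʳ (- (β ∙ w)) w b) ⟩
        quad D w + - (β ∙ w) * (w ∙ b)
          ≈⟨ +-congˡ (*-congˡ (trans (∙-comm w b) (sym (aβ≈b w)))) ⟩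
        quad D w + - (β ∙ w) * (a * (β ∙ w))
          ≈⟨ solve 3 (λ q y a → q :+ :- y :* (a :* y) := q :- a :* (y :* y)) refl (quad D w) (β ∙ w) a ⟩
        quad D w - a * ((β ∙ w) * (β ∙ w)) ∎

      complete-square : ∀ v → let y = v zero + β ∙ (v ∘ suc) in
        quad B v ≈ a * (y * y) + quad S (v ∘ suc)
      complete-square v = begin
        quad B v
          ≈⟨ quad-block v ⟩
        a * (x * x) + (x * (b ∙ w) + x * (b ∙ w)) + quad D w
          ≈⟨ +-congʳ (+-congˡ (+-cong (*-congˡ (aβ≈b w)) (*-congˡ (aβ≈b w)))) ⟨
        a * (x * x) + (x * (a * (β ∙ w)) + x * (a * (β ∙ w))) + quad D w
          ≈⟨ solve 4 (λ a x z q → a :* (x :* x) :+ (x :* (a :* z) :+ x :* (a :* z)) :+ q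
               := a :* ((x :+ z) :* (x :+ z)) :+ (q :- a :* (z :* z))) refl a x (β ∙ w) (quad D w) ⟩
        a * ((x + β ∙ w) * (x + β ∙ w)) + (quad D w - a * ((β ∙ w) * (β ∙ w)))
          ≈⟨ +-congˡ (quad-S w) ⟨
        a * ((x + β ∙ w) * (x + β ∙ w)) + quad S w ∎
        where
        x = v zero
        w = v ∘ suc

      -- The first coordinate is free, and the value -z makes the completed square vanish, so every
      -- value of the form of `S` is a value of the form of `B`. The same lift carries kernel
      -- vectors of `S` to kernel vectors of `B`.
      S-psd : PosSemidef B → PosSemidef S
      S-psd psd w = nonNeg-resp (begin
        quad B ((- z) ∷ w)                       ≈⟨ complete-square ((- z) ∷ w) ⟩
        a * ((- z + z) * (- z + z)) + quad S w   ≈⟨ solve 3 (λ a z q →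
                                                      a :* ((:- z :+ z) :* (:- z :+ z)) :+ q := q) refl a z (quad S w) ⟩
        quad S w                                 ∎) (psd ((- z) ∷ w))
        where z = β ∙ w

      kernel-extends : ∃ (IsKernelVector S) → ∃ (IsKernelVector B)
      kernel-extends (w , (i , wi≉0) , Sw≈0) = v , (suc i , wi≉0) , Bv≈0
        where
        z = β ∙ w
        v : Vector Carrier (suc n)
        v = (- z) ∷ w
        Bv≈0 : ∀ j → B j ∙ v ≈ 0#
        Bv≈0 zero = begin
          a * - z + b ∙ w           ≈⟨ +-congˡ (aβ≈b w) ⟨
          a * - z + a * z           ≈⟨ solve 2 (λ a z → a :* :- z :+ a :* z := con (+ 0)) refl a z ⟩
          0#                        ∎
        Bv≈0 (suc j) = begin
          B (suc j) zero * - z + D j ∙ w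
            ≈⟨ +-congʳ (*-congʳ (B-sym (suc j) zero)) ⟩
          b j * - z + D j ∙ w
            ≈⟨ solve 3 (λ x z d → x :* :- z :+ d := d :- x :* z) refl (b j) z (D j ∙ w) ⟩
          D j ∙ w - b j * z
            ≈⟨ S-row w j ⟨
          S j ∙ w
            ≈⟨ Sw≈0 j ⟩
          0# ∎

      -- With x = y - z the bound follows from x² ≤ 2y² + 2z² and z² ≤ K|w|²;
      -- t is chosen so that 2t ≤ a and (2K + 1)t ≤ ε.
      definite-extends : ∀ ε → 0# < ε → (∀ w → ε * (w ∙ w) ≤ quad S w) →
        ∃[ t ] 0# < t × (∀ v → t * (v ∙ v) ≤ quad B v)
      definite-extends ε 0<ε bound with linear-form-bounded β
      ... | K , 0≤K , z²≤K|w|² = t , 0<t , λ v →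
        let x = v zero
            w = v ∘ suc
            z = β ∙ w
            s = w ∙ w
            y = x + z
        in nonNeg⇒≤ (nonNeg-resp (begin
          (t * ((y + z) * (y + z)) + (a - (t + t)) * (y * y))
            + (((ε - m * t) * s + (quad S w - ε * s)) + (t + t) * (K * s - z * z))
            ≈⟨ solve 9 (λ t x z a s K q ε o →
                 (t :* ((x :+ z :+ z) :* (x :+ z :+ z)) :+ (a :- (t :+ t)) :* ((x :+ z) :* (x :+ z)))
                   :+ (((ε :- (K :+ K :+ o) :* t) :* s :+ (q :- ε :* s)) :+ (t :+ t) :* (K :* s :- z :* z))
                 := (a :* ((x :+ z) :* (x :+ z)) :+ q) :- t :* (x :* x :+ o :* s)) refl
                 t x z a s K (quad S w) ε 1# ⟩
          (a * (y * y) + quad S w) - t * (x * x + 1# * s)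
            ≈⟨ +-cong (sym (complete-square v)) (-‿cong (*-congˡ (+-congˡ (*-identityˡ s)))) ⟩
          quad B v - t * (v ∙ v) ∎)
          (+-nonNeg
            (+-nonNeg (*-nonNeg (<⇒≤ 0<t) (square-nonNeg _)) (*-nonNeg 2t≤a (square-nonNeg _)))
            (+-nonNeg (+-nonNeg (*-nonNeg mt≤ε (norm²-nonNeg w)) (≤⇒nonNeg (bound w)))
              (*-nonNeg (+-nonNeg (<⇒≤ 0<t) (<⇒≤ 0<t)) (≤⇒nonNeg (z²≤K|w|² w))))))
        where
        m = K + K + 1#
        0≤m : 0# ≤ m
        0≤m = +-nonNeg (+-nonNeg 0≤K 0≤K) 0≤1
        k = ε + ε + m * a
        0<k : 0# < k
        0<k = +-pos (+-pos 0<ε (<⇒≤ 0<ε)) (*-nonNeg 0≤m (<⇒≤ 0<a))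
        t = a * ε * k ⁻¹
        0<t : 0# < t
        0<t = *-pos (*-pos 0<a 0<ε) (⁻¹-pos 0<k)
        kk⁻¹≈1 = ⁻¹-inverse k (<⇒≉ 0<k)
        2t≤a : 0# ≤ a - (t + t)
        2t≤a = nonNeg-resp (begin
          a * k ⁻¹ * (m * a)
            ≈⟨ solve 4 (λ a m ε i → a :* i :* (m :* a)
                 := a :* ((ε :+ ε :+ m :* a) :* i) :- (a :* ε :* i :+ a :* ε :* i)) refl a m ε (k ⁻¹) ⟩
          a * (k * k ⁻¹) - (t + t)
            ≈⟨ +-congʳ (trans (*-congˡ kk⁻¹≈1) (*-identityʳ a)) ⟩
          a - (t + t) ∎)
          (*-nonNeg (*-nonNeg (<⇒≤ 0<a) (⁻¹-nonNeg 0<k)) (*-nonNeg 0≤m (<⇒≤ 0<a)))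
        mt≤ε : 0# ≤ ε - m * t
        mt≤ε = nonNeg-resp (begin
          ε * k ⁻¹ * (ε + ε)
            ≈⟨ solve 4 (λ a m ε i → ε :* i :* (ε :+ ε)
                 := ε :* ((ε :+ ε :+ m :* a) :* i) :- m :* (a :* ε :* i)) refl a m ε (k ⁻¹) ⟩
          ε * (k * k ⁻¹) - m * t
            ≈⟨ +-congʳ (trans (*-congˡ kk⁻¹≈1) (*-identityʳ ε)) ⟩
          ε - m * t ∎)
          (*-nonNeg (*-nonNeg (<⇒≤ 0<ε) (⁻¹-nonNeg 0<k)) (+-nonNeg (<⇒≤ 0<ε) (<⇒≤ 0<ε)))

  -- Stands in for compactness of the unit sphere: a semidefinite form without kernel has a uniform
  -- lower bound. The induction is elimination, since a zero pivot yields the first unit vector as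
  -- kernel vector, and otherwise either alternative lifts from the Schur complement.
  psd-dichotomy : ∀ {n} (B : SquareMatrix n) → IsSymmetric B → PosSemidef B →
    ∃ (IsKernelVector B) ⊎ ∃[ ε ] 0# < ε × (∀ v → ε * (v ∙ v) ≤ quad B v)
  psd-dichotomy {zero} B _ _ = inj₂ (1# , 0<1 , λ v → ≤.reflexive (zeroʳ 1#))
  psd-dichotomy {suc n} B B-sym psd with Block.a B B-sym ≤.≟ 0#
  ... | yes a≈0 = inj₁ (kernel-of-zero-row a≈0 (a≈0⇒b≈0 psd a≈0))
    where open Block B B-sym
  ... | no a≉0 = [ inj₁ ∘ kernel-extends , (λ (ε , 0<ε , bound) → inj₂ (definite-extends ε 0<ε bound)) ]′
                   (psd-dichotomy S S-sym (S-psd psd))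
    where
    open Block B B-sym
    open Schur (λ a≤0 → a≉0 (≤.antisym a≤0 (0≤a psd)))

  δ : ∀ {n} → SquareMatrix n
  δ i j = if does (i Fin.≟ j) then 1# else 0#

  δ-∙ : ∀ {n} i (v : Vector Carrier n) → δ i ∙ v ≈ v i
  δ-∙ i v = trans
    (sum-single (λ j → δ i j * v j) i λ j j≢i → trans
      (*-congʳ (reflexive (≡.cong (if_then 1# else 0#) (dec-false (i Fin.≟ j) (j≢i ∘ ≡.sym)))))
      (zeroˡ (v j)))
    (trans (*-congʳ (reflexive (≡.cong (if_then 1# else 0#) (dec-true (i Fin.≟ i) ≡.refl))))
      (*-identityˡ (v i)))

  δ-sym : ∀ {n} → IsSymmetric (δ {n})
  δ-sym i j with i Fin.≟ j
  ... | yes ≡.refl = reflexive (≡.cong (if_then 1# else 0#) (≡.sym (dec-true (i Fin.≟ i) ≡.refl)))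
  ... | no  i≢j    = reflexive (≡.cong (if_then 1# else 0#) (≡.sym (dec-false (j Fin.≟ i) (i≢j ∘ ≡.sym))))

  module Shift {n} (A : SquareMatrix n) (t : Carrier) where
    A+t : SquareMatrix n
    A+t i j = A i j + t * δ i j

    row : ∀ v i → A+t i ∙ v ≈ A i ∙ v + t * v i
    row v i = begin
      sumFin (λ j → (A i j + t * δ i j) * v j)
        ≈⟨ sum-cong (λ j → solve 4 (λ a t d x → (a :+ t :* d) :* x := a :* x :+ t :* (d :* x))
             refl (A i j) t (δ i j) (v j)) ⟩
      sumFin (λ j → A i j * v j + t * (δ i j * v j))
        ≈⟨ ∑-distrib-+ (λ j → A i j * v j) _ ⟩
      A i ∙ v + sumFin (λ j → t * (δ i j * v j))
        ≈⟨ +-congˡ (*-distribˡ-sum t (λ j → δ i j * v j)) ⟨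
      A i ∙ v + t * (δ i ∙ v)
        ≈⟨ +-congˡ (*-congˡ (δ-∙ i v)) ⟩
      A i ∙ v + t * v i ∎

    quad-shift : ∀ v → quad A+t v ≈ quad A v + t * (v ∙ v)
    quad-shift v = begin
      v ∙ (λ i → A+t i ∙ v)             ≈⟨ sum-cong (λ i → *-congˡ (row v i)) ⟩
      v ∙ (λ i → A i ∙ v + t * v i)     ≈⟨ ∙-distribˡ-+ v _ _ ⟩
      quad A v + v ∙ (λ i → t * v i)    ≈⟨ +-congˡ (∙-scaleʳ t v v) ⟩
      quad A v + t * (v ∙ v)            ∎

  -- If the bound fails at v, the supremum τ of the t for which A + t is not
  -- positive semidefinite exists and A + τ is positive semidefinite but not
  -- definite, so -τ is an eigenvalue, and -τ < μ.
  rayleigh-bound : ∀ {n} (A : SquareMatrix n) → IsSymmetric A →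
    (∃[ K ] ∀ v → 0# ≤ quad A v + K * (v ∙ v)) →
    ∀ μ → (∀ t v → (∃[ i ] ¬ v i ≈ 0#) → (∀ i → A i ∙ v ≈ t * v i) → μ ≤ t) →
    ∀ v → 0# ≤ quad A v + - μ * (v ∙ v)
  rayleigh-bound {n} A A-sym (K , K-bound) μ μ-least v₀ = ≮⇒≥ λ q<0 → absurd q<0
    where
    q : Carrier → Vector Carrier n → Carrier
    q t v = quad A v + t * (v ∙ v)

    q-shift : ∀ s t v → q s v ≈ q t v + (s - t) * (v ∙ v)
    q-shift s t v = solve 4 (λ a s t N → a :+ s :* N := a :+ t :* N :+ (s :- t) :* N)
      refl (quad A v) s t (v ∙ v)

    q-mono : ∀ {s t} v → s ≤ t → 0# ≤ q s v → 0# ≤ q t v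
    q-mono {s} {t} v s≤t 0≤q = nonNeg-resp (sym (q-shift t s v))
      (+-nonNeg 0≤q (*-nonNeg (≤⇒nonNeg s≤t) (norm²-nonNeg v)))

    Indefinite : Carrier → Set ℓ
    Indefinite t = ∃[ v ] q t v < 0#

    psd⇒upper : ∀ t → (∀ v → 0# ≤ q t v) → IsUpperBound Indefinite t
    psd⇒upper t psd s (v , q<0) = ≮⇒≥ λ t<s → q<0 (q-mono v (<⇒≤ t<s) (psd v))

    absurd : q (- μ) v₀ < 0# → ⊥
    absurd q<0 with complete Indefinite (- μ , v₀ , q<0) (K , psd⇒upper K K-bound)
    ... | τ , upper , least = conclude (psd-dichotomy A+t A+τ-sym λ v →
                                nonNeg-resp (sym (quad-shift v)) (psd v))
      where
      open Shift A τ

      A+τ-sym : IsSymmetric A+t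
      A+τ-sym i j = +-cong (A-sym i j) (*-congˡ (δ-sym i j))

      psd : ∀ v → 0# ≤ q τ v
      psd v = ≮⇒≥ λ qτ<0 →
        let N   = v ∙ v
            e   = - q τ v
            0<e : 0# < e
            0<e = λ e≤0 → qτ<0 (nonNeg-resp (solve 1 (λ x → :- :- x := x) refl (q τ v)) (x≤0⇒0≤-x e≤0))
            k   = 1# + N
            0<k : 0# < k
            0<k = +-pos 0<1 (norm²-nonNeg v)
            -- Indefiniteness is an open condition: for d = e/(1 + N) the form at τ + d has the
            -- value -e + dN = -d, which is still negative, so τ + d lies in a set bounded above by
            -- τ.
            d   = e * k ⁻¹
            0<d : 0# < d
            0<d = *-pos 0<e (⁻¹-pos 0<k)
            -d≈q : - d ≈ q (τ + d) v
            -d≈q = begin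
              - d
                ≈⟨ solve 2 (λ d e → :- d := :- e :+ e :- d) refl d e ⟩
              - e + e - d
                ≈⟨ +-congʳ (+-congˡ (trans (sym (*-identityʳ e)) (*-congˡ (sym (⁻¹-inverse k (<⇒≉ 0<k)))))) ⟩
              - e + e * (k * k ⁻¹) - d
                ≈⟨ solve 6 (λ a τ N e i o → :- (:- (a :+ τ :* N)) :+ e :* ((o :+ N) :* i) :- e :* i
                     := (a :+ (τ :+ e :* i) :* N) :+ (o :* (e :* i) :- e :* i))
                     refl (quad A v) τ N e (k ⁻¹) 1# ⟩
              q (τ + d) v + (1# * d - d)
                ≈⟨ +-congˡ (trans (+-congʳ (*-identityˡ d)) (-‿inverseʳ d)) ⟩
              q (τ + d) v + 0#
                ≈⟨ +-identityʳ _ ⟩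
              q (τ + d) v ∎
            indefinite : Indefinite (τ + d)
            indefinite = v , λ 0≤q → 0<d (nonNeg⇒≤
              (nonNeg-resp (trans (sym -d≈q) (sym (+-identityˡ (- d)))) 0≤q))
        in 0<d (nonNeg⇒≤ (nonNeg-resp
             (solve 2 (λ τ d → τ :- (τ :+ d) := con (+ 0) :- d) refl τ d)
             (≤⇒nonNeg (upper (τ + d) indefinite))))

      conclude : ∃ (IsKernelVector A+t) ⊎ ∃[ ε ] 0# < ε × (∀ v → ε * (v ∙ v) ≤ quad A+t v) → ⊥
      conclude (inj₁ (w , w≉0 , A+τw≈0)) = q<0 (q-mono v₀ τ≤-μ (psd v₀))
        where
        μ≤-τ : μ ≤ - τ
        μ≤-τ = μ-least (- τ) w w≉0 λ i → begin
          A i ∙ w                          ≈⟨ solve 3 (λ a t x → a := a :+ t :* x :+ :- t :* x) refl (A i ∙ w) τ (w i) ⟩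
          A i ∙ w + τ * w i + - τ * w i    ≈⟨ +-congʳ (trans (sym (row w i)) (A+τw≈0 i)) ⟩
          0# + - τ * w i                   ≈⟨ +-identityˡ _ ⟩
          - τ * w i                        ∎
        τ≤-μ : τ ≤ - μ
        τ≤-μ = nonNeg⇒≤ (nonNeg-resp (+-comm (- τ) (- μ)) (≤⇒nonNeg μ≤-τ))
      -- A uniform bound ε would leave A + (τ - ε) positive semidefinite, making τ - ε an upper
      -- bound below the supremum.
      conclude (inj₂ (ε , 0<ε , bound)) = 0<ε (nonNeg⇒≤ (nonNeg-resp
          (solve 2 (λ t e → t :- e :- t := con (+ 0) :- e) refl τ ε)
          (≤⇒nonNeg (least (τ - ε) (psd⇒upper (τ - ε) λ v → nonNeg-resp (begin
            quad A+t v - ε * (v ∙ v)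
              ≈⟨ +-congʳ (quad-shift v) ⟩
            quad A v + τ * (v ∙ v) - ε * (v ∙ v)
              ≈⟨ solve 4 (λ a t e N → a :+ t :* N :- e :* N := a :+ (t :- e) :* N) refl (quad A v) τ ε (v ∙ v) ⟩
            q (τ - ε) v ∎) (≤⇒nonNeg (bound v)))))))

-- Graph distance and its values on the corona

module Distance (G : Graph) (conn : Graph.Connected G) where
  open Graph G using (V; Walk)

  shortest : ∀ x y → Walk (dist G conn x y) x y
  shortest x y = proj₁ (proj₂ (distance G conn x y))

  dist-≤ : ∀ {k x y} → Walk k x y → dist G conn x y ℕ.≤ k
  dist-≤ {k} {x} {y} = proj₂ (proj₂ (distance G conn x y)) k

  dist-unique : ∀ x y {k} → Walk k x y → (∀ {j} → Walk j x y → k ℕ.≤ j) → dist G conn x y ≡ k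
  dist-unique x y w k-least = ℕ.≤-antisym (dist-≤ w) (k-least (shortest x y))

  dist-refl : ∀ x → dist G conn x x ≡ 0
  dist-refl x = dist-unique x x Graph.[] (λ _ → ℕ.z≤n)

module CoronaDistance (G H : Graph) (conn : Graph.Connected G) where
  private
    module G = Graph G
    module H = Graph H
    module G⊙H = Graph (G ⊙ H)
  open Distance G conn using (shortest; dist-≤)
  open Distance (G ⊙ H) (⊙-connected G H conn) using (dist-unique)
  open G⊙H using (Walk; []; _∷_)

  d : G.V → G.V → ℕ
  d = dist G conn

  d⊙ : G⊙H.V → G⊙H.V → ℕ
  d⊙ = dist (G ⊙ H) (⊙-connected G H conn)

  lift-walk : ∀ {k x y} → G.Walk k x y → Walk k (inj₁ x) (inj₁ y)
  lift-walk Graph.[]      = []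
  lift-walk (e Graph.∷ w) = e ∷ lift-walk w

  lift-walk-leaf : ∀ {k x y} j → G.Walk k x y → Walk (suc k) (inj₁ x) (inj₂ (y , j))
  lift-walk-leaf j Graph.[]      = ≡.refl ∷ []
  lift-walk-leaf j (e Graph.∷ w) = e ∷ lift-walk-leaf j w

  base : G⊙H.V → G.V
  base (inj₁ x)       = x
  base (inj₂ (x , _)) = x

  -- The number of edges between a vertex and its base point. Unless both vertices are leaves of the
  -- same copy, their distance is the sum of the two heights and the distance of the base points in
  -- G.
  height : G⊙H.V → ℕ
  height (inj₁ _) = 0
  height (inj₂ _) = 1

  -- A walk that stays inside one copy of H is the only exception to the lower
  -- bound: all others descend to G.
  project-walk : ∀ {k u v} → Walk k u v →
    (∃[ l ] G.Walk l (base u) (base v) × height u ℕ.+ (height v ℕ.+ l) ℕ.≤ k)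
      ⊎ (base u ≡ base v × height u ≡ 1 × height v ≡ 1)
  project-walk {u = inj₁ x} [] = inj₁ (0 , Graph.[] , ℕ.z≤n)
  project-walk {u = inj₂ x} [] = inj₂ (≡.refl , ≡.refl , ≡.refl)
  project-walk {suc k} {inj₁ x} {v} (_∷_ {y = inj₁ z} e w) with project-walk w
  ... | inj₁ (l , p , le) = inj₁ (suc l , e Graph.∷ p ,
          ℕ.≤-trans (ℕ.≤-reflexive (ℕ.+-suc (height v) l)) (ℕ.s≤s le))
  project-walk {suc k} {inj₁ x} {v} (_∷_ {y = inj₂ _} ≡.refl w) with project-walk w
  ... | inj₁ (l , p , le) = inj₁ (l , p , ℕ.≤-trans (ℕ.n≤1+n _) (ℕ.m≤n⇒m≤1+n le))
  ... | inj₂ (≡.refl , _ , hv≡1) = inj₁ (0 , Graph.[] ,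
          ℕ.≤-trans (ℕ.≤-reflexive (≡.trans (ℕ.+-identityʳ (height v)) hv≡1)) (ℕ.s≤s ℕ.z≤n))
  project-walk {suc k} {inj₂ _} (_∷_ {y = inj₁ z} ≡.refl w) with project-walk w
  ... | inj₁ (l , p , le) = inj₁ (l , p , ℕ.s≤s le)
  project-walk {suc k} {inj₂ _} (_∷_ {y = inj₂ _} (≡.refl , _) w) with project-walk w
  ... | inj₁ (l , p , le) = inj₁ (l , p , ℕ.m≤n⇒m≤1+n le)
  ... | inj₂ (b≡ , _ , hv≡1) = inj₂ (b≡ , ≡.refl , hv≡1)

  dist-lower : ∀ {k} u v → Walk k u v → ¬ (base u ≡ base v × height u ≡ 1 × height v ≡ 1) →
               height u ℕ.+ (height v ℕ.+ d (base u) (base v)) ℕ.≤ k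
  dist-lower u v w ¬same with project-walk w
  ... | inj₂ same         = contradiction same ¬same
  ... | inj₁ (l , p , le) = ℕ.≤-trans (ℕ.+-monoʳ-≤ (height u) (ℕ.+-monoʳ-≤ (height v) (dist-≤ p))) le

  dist-core-core : ∀ x y → d⊙ (inj₁ x) (inj₁ y) ≡ d x y
  dist-core-core x y = dist-unique (inj₁ x) (inj₁ y) (lift-walk (shortest x y))
    (λ w → dist-lower (inj₁ x) (inj₁ y) w λ { (_ , () , _) })

  dist-core-leaf : ∀ x y j → d⊙ (inj₁ x) (inj₂ (y , j)) ≡ suc (d x y)
  dist-core-leaf x y j = dist-unique (inj₁ x) (inj₂ (y , j)) (lift-walk-leaf j (shortest x y))
    (λ w → dist-lower (inj₁ x) (inj₂ (y , j)) w λ { (_ , () , _) })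

  dist-leaf-core : ∀ x i y → d⊙ (inj₂ (x , i)) (inj₁ y) ≡ suc (d x y)
  dist-leaf-core x i y = dist-unique (inj₂ (x , i)) (inj₁ y) (≡.refl ∷ lift-walk (shortest x y))
    (λ w → dist-lower (inj₂ (x , i)) (inj₁ y) w λ { (_ , _ , ()) })

  dist-leaf-leaf : ∀ {x y} i j → x ≢ y → d⊙ (inj₂ (x , i)) (inj₂ (y , j)) ≡ suc (suc (d x y))
  dist-leaf-leaf {x} {y} i j x≢y = dist-unique (inj₂ (x , i)) (inj₂ (y , j)) (≡.refl ∷ lift-walk-leaf j (shortest x y))
    (λ w → dist-lower (inj₂ (x , i)) (inj₂ (y , j)) w λ { (x≡y , _) → x≢y x≡y })

  dist-adjacent-leaves : ∀ x {i j} → i H.~ j → d⊙ (inj₂ (x , i)) (inj₂ (x , j)) ≡ 1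
  dist-adjacent-leaves x {i} {j} i~j = dist-unique (inj₂ (x , i)) (inj₂ (x , j)) ((≡.refl , i~j) ∷ []) λ where
    []      → contradiction i~j (H.~-irrefl ≡.refl)
    (_ ∷ _) → ℕ.s≤s ℕ.z≤n

  dist-nonadjacent-leaves : ∀ x {i j} → i ≢ j → ¬ i H.~ j → d⊙ (inj₂ (x , i)) (inj₂ (x , j)) ≡ 2
  dist-nonadjacent-leaves x {i} {j} i≢j i≁j =
    dist-unique (inj₂ (x , i)) (inj₂ (x , j)) (_∷_ {y = inj₁ x} ≡.refl (≡.refl ∷ [])) λ where
    []              → contradiction ≡.refl i≢j
    ((_ , i~j) ∷ []) → contradiction i~j i≁j
    (_ ∷ (_ ∷ _))   → ℕ.s≤s (ℕ.s≤s ℕ.z≤n)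

-- Sums over the vertices of a graph and of a corona

module GraphSums {ℓ} (ℝ : CompleteOrderedField ℓ) where
  open FiniteSums ℝ
  open import Relation.Binary.Reasoning.Setoid setoid

  module _ (G : Graph) where
    open Graph G using (V; vertex; V↔Fin)

    vertex∘to : ∀ x → vertex (Inverse.to V↔Fin x) ≡ x
    vertex∘to = Inverse.strictlyInverseʳ V↔Fin

    to∘vertex : ∀ i → Inverse.to V↔Fin (vertex i) ≡ i
    to∘vertex = Inverse.strictlyInverseˡ V↔Fin

    ∑-cong : {u v : V → Carrier} → (∀ x → u x ≈ v x) → ∑ ℝ G u ≈ ∑ ℝ G v
    ∑-cong u≈v = sum-cong (u≈v ∘ vertex)

    ∑-+ : (u v : V → Carrier) → ∑ ℝ G (λ x → u x + v x) ≈ ∑ ℝ G u + ∑ ℝ G v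
    ∑-+ u v = ∑-distrib-+ (u ∘ vertex) (v ∘ vertex)

    ∑-*ˡ : ∀ c (u : V → Carrier) → ∑ ℝ G (λ x → c * u x) ≈ c * ∑ ℝ G u
    ∑-*ˡ c u = sym (*-distribˡ-sum c (u ∘ vertex))

    ∑-*ʳ : ∀ c (u : V → Carrier) → ∑ ℝ G (λ x → u x * c) ≈ ∑ ℝ G u * c
    ∑-*ʳ c u = sym (*-distribʳ-sum c (u ∘ vertex))

    ∑-single : ∀ (u : V → Carrier) x → (∀ y → y ≢ x → u y ≈ 0#) → ∑ ℝ G u ≈ u x
    ∑-single u x u≈0 = trans
      (sum-single (u ∘ vertex) (Inverse.to V↔Fin x) λ j j≢ → u≈0 (vertex j)
        λ vj≡x → j≢ (≡.trans (≡.sym (to∘vertex j)) (≡.cong (Inverse.to V↔Fin) vj≡x)))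
      (reflexive (≡.cong u (vertex∘to x)))

    ∑-const : ∀ x → ∑ ℝ G (λ _ → x) ≈ fromℕ (Graph.∣V∣ G) * x
    ∑-const = sum-const (Graph.∣V∣ G)

  sum-+-split : ∀ m n (v : Vector Carrier (m ℕ.+ n)) →
                sumFin v ≈ sumFin (λ i → v (i ↑ˡ n)) + sumFin (λ j → v (m ↑ʳ j))
  sum-+-split zero    n v = sym (+-identityˡ _)
  sum-+-split (suc m) n v = trans (+-congˡ (sum-+-split m n (v ∘ suc))) (sym (+-assoc _ _ _))

  sum-*-split : ∀ m n (v : Vector Carrier (m ℕ.* n)) →
                sumFin v ≈ sumFin {m} (λ i → sumFin {n} (λ j → v (combine i j)))
  sum-*-split zero    n v = refl
  sum-*-split (suc m) n v = trans (sum-+-split n (m ℕ.* n) v) (+-congˡ (sum-*-split m n (λ k → v (n ↑ʳ k))))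

  -- The enumeration of `G ⊙ H` decodes an index by `splitAt` and then by `remQuot`; `locate` is the
  -- second half of this decoding. Cutting the sum along `↑ˡ`, `↑ʳ` and `combine` lets each decoding
  -- cancel against its encoding.
  ∑-⊙ : ∀ G H (φ : Graph.V (G ⊙ H) → Carrier) →
        ∑ ℝ (G ⊙ H) φ ≈ ∑ ℝ G (λ x → φ (inj₁ x)) + ∑ ℝ G (λ x → ∑ ℝ H (λ i → φ (inj₂ (x , i))))
  ∑-⊙ G H φ = trans (sum-+-split G.∣V∣ (G.∣V∣ ℕ.* H.∣V∣) (φ ∘ vertex))
    (+-cong
      (sum-cong λ i → reflexive (≡.cong (φ ∘ locate) (Fin.splitAt-↑ˡ G.∣V∣ i (G.∣V∣ ℕ.* H.∣V∣))))
      (trans (sum-*-split G.∣V∣ H.∣V∣ (λ k → φ (vertex (G.∣V∣ ↑ʳ k))))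
        (sum-cong λ i → sum-cong λ j → reflexive (≡.trans
          (≡.cong (φ ∘ locate) (Fin.splitAt-↑ʳ G.∣V∣ (G.∣V∣ ℕ.* H.∣V∣) (combine i j)))
          (≡.cong (λ (k , l) → φ (inj₂ (G.vertex k , H.vertex l))) (Fin.remQuot-combine i j))))))
    where
    module G = Graph G
    module H = Graph H
    open Graph (G ⊙ H) using (vertex)
    locate : Fin G.∣V∣ ⊎ Fin (G.∣V∣ ℕ.* H.∣V∣) → Graph.V (G ⊙ H)
    locate = [ (λ i → inj₁ (G.vertex i))
             , (λ k → let i , j = remQuot {G.∣V∣} H.∣V∣ k in inj₂ (G.vertex i , H.vertex j)) ]′

  regular-row-sum : ∀ κ H → Regular κ H → ∀ x → ∑ ℝ H (adjacencyMatrix ℝ H x) ≈ fromℕ κ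
  regular-row-sum κ H regular x = trans (count (Graph.vertex H)) (reflexive (≡.cong fromℕ (regular x)))
    where
    open Graph H using (V; _~?_)
    -- Generalised to an arbitrary listing of vertices, because the induction passes to tails of the
    -- enumeration.
    count : ∀ {m} (v : Fin m → V) →
            sumFin (adjacencyMatrix ℝ H x ∘ v) ≈ fromℕ (length (filter (x ~?_) (tabulate v)))
    count {zero}  v = refl
    count {suc m} v with x ~? v zero
    ... | yes _ = +-congˡ (count (v ∘ suc))
    ... | no  _ = trans (+-identityˡ _) (count (v ∘ suc))

  adjacency-sym : ∀ H i j → adjacencyMatrix ℝ H i j ≈ adjacencyMatrix ℝ H j i
  adjacency-sym H i j with Graph._~?_ H i j
  ... | yes i~j = reflexive (≡.cong (if_then 1# else 0#)
                    (≡.sym (dec-true (Graph._~?_ H j i) (Graph.~-sym H i~j))))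
  ... | no  i≁j = reflexive (≡.cong (if_then 1# else 0#)
                    (≡.sym (dec-false (Graph._~?_ H j i) (i≁j ∘ Graph.~-sym H))))

-- The distance form of the corona

module CoronaForm {ℓ} (ℝ : CompleteOrderedField ℓ) (G H : Graph) (conn : Graph.Connected G) where
  open FiniteSums ℝ
  open GraphSums ℝ
  open CoronaDistance G H conn
  open import Relation.Binary.Reasoning.Setoid setoid
  private
    module G = Graph G
    module H = Graph H

  D : Matrix ℝ G
  D = distanceMatrix ℝ G conn

  D⊙ : Matrix ℝ (G ⊙ H)
  D⊙ = distanceMatrix ℝ (G ⊙ H) (⊙-connected G H conn)

  A : Matrix ℝ H
  A = adjacencyMatrix ℝ H

  -- Within one copy the distance is 0 for equal leaves, 1 for adjacent ones and 2 otherwise, so it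
  -- falls short of 2 by the entries of 2I + A. This is the summand 2I.
  twice-identity : Matrix ℝ H
  twice-identity i j = if does (i H.≟ j) then 1# + 1# else 0#

  -- The amount by which a distance between leaves falls short of d(x,y) + 2.
  defect : Matrix ℝ (G ⊙ H)
  defect (inj₂ (x , i)) (inj₂ (y , j)) = if does (x G.≟ y) then twice-identity i j + A i j else 0#
  defect _              _              = 0#

  defect-same-copy : ∀ x i j → defect (inj₂ (x , i)) (inj₂ (x , j)) ≈ twice-identity i j + A i j
  defect-same-copy x i j = reflexive (≡.cong (if_then twice-identity i j + A i j else 0#)
    (dec-true (x G.≟ x) ≡.refl))

  defect-other-copy : ∀ {x y} i j → x ≢ y → defect (inj₂ (x , i)) (inj₂ (y , j)) ≈ 0#
  defect-other-copy {x} {y} i j x≢y = reflexive (≡.cong (if_then twice-identity i j + A i j else 0#)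
    (dec-false (x G.≟ y) x≢y))

  twice-identity-diagonal : ∀ i → twice-identity i i ≈ 1# + 1#
  twice-identity-diagonal i = reflexive (≡.cong (if_then 1# + 1# else 0#)
    (dec-true (i H.≟ i) ≡.refl))

  twice-identity-off-diagonal : ∀ {i j} → i ≢ j → twice-identity i j ≈ 0#
  twice-identity-off-diagonal {i} {j} i≢j = reflexive (≡.cong (if_then 1# + 1# else 0#)
    (dec-false (i H.≟ j) i≢j))

  A-nonadjacent : ∀ {i j} → ¬ i H.~ j → A i j ≈ 0#
  A-nonadjacent {i} {j} i≁j = reflexive (≡.cong (if_then 1# else 0#) (dec-false (i H.~? j) i≁j))

  D-same-copy : ∀ x i j →
    D⊙ (inj₂ (x , i)) (inj₂ (x , j)) + (twice-identity i j + A i j) ≈ 1# + (1# + 0#)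
  D-same-copy x i j with i H.≟ j
  ... | yes ≡.refl = begin
    D⊙ u u + (twice-identity i i + A i i)
      ≈⟨ +-cong (reflexive (≡.cong fromℕ (Distance.dist-refl (G ⊙ H) (⊙-connected G H conn) u)))
           (+-cong (twice-identity-diagonal i) (A-nonadjacent (H.~-irrefl ≡.refl))) ⟩
    0# + (1# + 1# + 0#)
      ≈⟨ trans (+-identityˡ _) (+-assoc 1# 1# 0#) ⟩
    1# + (1# + 0#) ∎
    where u = inj₂ (x , i)
  ... | no i≢j with i H.~? j
  ...   | yes i~j = begin
    D⊙ (inj₂ (x , i)) (inj₂ (x , j)) + (twice-identity i j + 1#)
      ≈⟨ +-cong (reflexive (≡.cong fromℕ (dist-adjacent-leaves x i~j)))
           (+-congʳ (twice-identity-off-diagonal i≢j)) ⟩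
    1# + 0# + (0# + 1#)
      ≈⟨ +-cong (+-identityʳ 1#) (+-comm 0# 1#) ⟩
    1# + (1# + 0#) ∎
  ...   | no i≁j = begin
    D⊙ (inj₂ (x , i)) (inj₂ (x , j)) + (twice-identity i j + 0#)
      ≈⟨ +-cong (reflexive (≡.cong fromℕ (dist-nonadjacent-leaves x i≢j i≁j)))
           (trans (+-identityʳ _) (twice-identity-off-diagonal i≢j)) ⟩
    1# + (1# + 0#) + 0#
      ≈⟨ +-identityʳ _ ⟩
    1# + (1# + 0#) ∎

  D-leaf-leaf : ∀ x i y j →
    D⊙ (inj₂ (x , i)) (inj₂ (y , j)) + defect (inj₂ (x , i)) (inj₂ (y , j)) ≈ 1# + (1# + D x y)
  D-leaf-leaf x i y j with x G.≟ y
  ... | no x≢y = trans (+-cong (reflexive (≡.cong fromℕ (dist-leaf-leaf i j x≢y)))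
                   (defect-other-copy i j x≢y)) (+-identityʳ _)
  ... | yes ≡.refl = begin
    D⊙ (inj₂ (x , i)) (inj₂ (x , j)) + defect (inj₂ (x , i)) (inj₂ (x , j))
      ≈⟨ +-congˡ (defect-same-copy x i j) ⟩
    D⊙ (inj₂ (x , i)) (inj₂ (x , j)) + (twice-identity i j + A i j)
      ≈⟨ D-same-copy x i j ⟩
    1# + (1# + 0#)
      ≈⟨ +-congˡ (+-congˡ (reflexive (≡.cong fromℕ (Distance.dist-refl G conn x)))) ⟨
    1# + (1# + D x x) ∎

  leaf-term : (H.V → Carrier) → H.V → Carrier
  leaf-term g i = (1# + 1#) * g i + apply ℝ H A g i

  defect-row : ∀ (g : G.V → H.V → Carrier) x i →
    ∑ ℝ G (λ y → ∑ ℝ H (λ j → defect (inj₂ (x , i)) (inj₂ (y , j)) * g y j)) ≈ leaf-term (g x) i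
  defect-row g x i = begin
    ∑ ℝ G (λ y → ∑ ℝ H (λ j → defect (inj₂ (x , i)) (inj₂ (y , j)) * g y j))
      ≈⟨ ∑-single G _ x (λ y y≢x → sum-≈0 λ k → other y y≢x (H.vertex k)) ⟩
    ∑ ℝ H (λ j → defect (inj₂ (x , i)) (inj₂ (x , j)) * g x j)
      ≈⟨ ∑-cong H same ⟩
    ∑ ℝ H (λ j → twice-identity i j * g x j + A i j * g x j)
      ≈⟨ ∑-+ H (λ j → twice-identity i j * g x j) (λ j → A i j * g x j) ⟩
    ∑ ℝ H (λ j → twice-identity i j * g x j) + apply ℝ H A (g x) i
      ≈⟨ +-congʳ (trans (∑-single H (λ j → twice-identity i j * g x j) i off-diagonal) diagonal) ⟩
    leaf-term (g x) i ∎
    where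
    other : ∀ y → y ≢ x → ∀ j → defect (inj₂ (x , i)) (inj₂ (y , j)) * g y j ≈ 0#
    other y y≢x j = trans (*-congʳ (defect-other-copy i j (y≢x ∘ ≡.sym))) (zeroˡ _)
    same : ∀ j → defect (inj₂ (x , i)) (inj₂ (x , j)) * g x j ≈ twice-identity i j * g x j + A i j * g x j
    same j = trans (*-congʳ (defect-same-copy x i j)) (distribʳ _ _ _)
    off-diagonal : ∀ j → j ≢ i → twice-identity i j * g x j ≈ 0#
    off-diagonal j j≢i = trans (*-congʳ (twice-identity-off-diagonal (j≢i ∘ ≡.sym))) (zeroˡ _)
    diagonal : twice-identity i i * g x i ≈ (1# + 1#) * g x i
    diagonal = *-congʳ (twice-identity-diagonal i)

  module _ (φ : Graph.V (G ⊙ H) → Carrier) where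
    f : G.V → Carrier
    f x = φ (inj₁ x)

    g : G.V → H.V → Carrier
    g x i = φ (inj₂ (x , i))

    s F DF : G.V → Carrier
    s x  = ∑ ℝ H (g x)
    F x  = f x + s x
    DF x = apply ℝ G D F x

    S T : Carrier
    S = ∑ ℝ G f
    T = ∑ ℝ G s

    leaf-energy : Carrier
    leaf-energy = ∑ ℝ G (λ x → ∑ ℝ H (λ i → g x i * leaf-term (g x) i))

    ∑F≈S+T : ∑ ℝ G F ≈ S + T
    ∑F≈S+T = ∑-+ G f s

    mean : inner ℝ (G ⊙ H) (𝟏 ℝ (G ⊙ H)) φ ≈ ∑ ℝ G F
    mean = begin
      ∑ ℝ (G ⊙ H) (λ u → 1# * φ u)  ≈⟨ ∑-cong (G ⊙ H) (λ u → *-identityˡ (φ u)) ⟩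
      ∑ ℝ (G ⊙ H) φ                 ≈⟨ ∑-⊙ G H φ ⟩
      S + T                         ≈⟨ ∑F≈S+T ⟨
      ∑ ℝ G F                       ∎

    norm : inner ℝ (G ⊙ H) φ φ ≈ ∑ ℝ G (λ x → f x * f x + ∑ ℝ H (λ i → g x i * g x i))
    norm = trans (∑-⊙ G H (λ u → φ u * φ u)) (sym (∑-+ G (λ x → f x * f x) (λ x → ∑ ℝ H (λ i → g x i * g x i))))

    core-row : ∀ x → apply ℝ (G ⊙ H) D⊙ φ (inj₁ x) ≈ DF x + T
    core-row x = begin
      apply ℝ (G ⊙ H) D⊙ φ (inj₁ x)
        ≈⟨ ∑-⊙ G H (λ v → D⊙ (inj₁ x) v * φ v) ⟩
      ∑ ℝ G (λ y → D⊙ (inj₁ x) (inj₁ y) * f y)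
        + ∑ ℝ G (λ y → ∑ ℝ H (λ j → D⊙ (inj₁ x) (inj₂ (y , j)) * g y j))
        ≈⟨ +-cong
             (∑-cong G λ y → *-congʳ {f y} (reflexive (≡.cong fromℕ (dist-core-core x y))))
             (∑-cong G λ y → trans
               (∑-cong H λ j → *-congʳ {g y j} (reflexive (≡.cong fromℕ (dist-core-leaf x y j))))
               (∑-*ˡ H (1# + D x y) (g y))) ⟩
      ∑ ℝ G (λ y → D x y * f y) + ∑ ℝ G (λ y → (1# + D x y) * s y)
        ≈⟨ ∑-+ G (λ y → D x y * f y) (λ y → (1# + D x y) * s y) ⟨
      ∑ ℝ G (λ y → D x y * f y + (1# + D x y) * s y)
        ≈⟨ ∑-cong G (λ y → trans
             (+-congˡ (trans (distribʳ (s y) 1# (D x y)) (+-congʳ (*-identityˡ (s y)))))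
             (solve 3 (λ D f s → D :* f :+ (s :+ D :* s) := D :* (f :+ s) :+ s) refl (D x y) (f y) (s y))) ⟩
      ∑ ℝ G (λ y → D x y * F y + s y)
        ≈⟨ ∑-+ G (λ y → D x y * F y) s ⟩
      DF x + T ∎

    -- Once the shortfall is added back, a leaf is exactly one step further than its base point from
    -- every vertex. The extra step contributes the total sum of φ, which is 0, so the row agrees
    -- with `core-row` at the same base point.
    leaf-row : S + T ≈ 0# → ∀ x i →
      apply ℝ (G ⊙ H) D⊙ φ (inj₂ (x , i)) + leaf-term (g x) i ≈ DF x + T
    leaf-row S+T≈0 x i = begin
      apply ℝ (G ⊙ H) D⊙ φ u + leaf-term (g x) i
        ≈⟨ +-cong (∑-⊙ G H (λ v → D⊙ u v * φ v)) (sym (defect-row g x i)) ⟩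
      ∑ ℝ G (λ y → D⊙ u (inj₁ y) * f y)
        + ∑ ℝ G (λ y → ∑ ℝ H (λ j → D⊙ u (inj₂ (y , j)) * g y j))
        + ∑ ℝ G (λ y → ∑ ℝ H (λ j → defect u (inj₂ (y , j)) * g y j))
        ≈⟨ +-assoc _ _ _ ⟩
      ∑ ℝ G (λ y → D⊙ u (inj₁ y) * f y)
        + (∑ ℝ G (λ y → ∑ ℝ H (λ j → D⊙ u (inj₂ (y , j)) * g y j))
        + ∑ ℝ G (λ y → ∑ ℝ H (λ j → defect u (inj₂ (y , j)) * g y j)))
        ≈⟨ +-cong
             (∑-cong G λ y → *-congʳ {f y} (reflexive (≡.cong fromℕ (dist-leaf-core x i y))))
             (trans (sym (∑-+ G (λ y → ∑ ℝ H (λ j → D⊙ u (inj₂ (y , j)) * g y j))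
                            (λ y → ∑ ℝ H (λ j → defect u (inj₂ (y , j)) * g y j))))
               (∑-cong G λ y → trans
                 (sym (∑-+ H (λ j → D⊙ u (inj₂ (y , j)) * g y j) (λ j → defect u (inj₂ (y , j)) * g y j)))
                 (trans
                   (∑-cong H λ j → trans (sym (distribʳ (g y j) (D⊙ u (inj₂ (y , j))) (defect u (inj₂ (y , j)))))
                                         (*-congʳ {g y j} (D-leaf-leaf x i y j)))
                   (∑-*ˡ H (1# + (1# + D x y)) (g y))))) ⟩
      ∑ ℝ G (λ y → (1# + D x y) * f y) + ∑ ℝ G (λ y → (1# + (1# + D x y)) * s y)
        ≈⟨ ∑-+ G (λ y → (1# + D x y) * f y) (λ y → (1# + (1# + D x y)) * s y) ⟨
      ∑ ℝ G (λ y → (1# + D x y) * f y + (1# + (1# + D x y)) * s y)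
        ≈⟨ ∑-cong G (λ y → trans
             (solve 4 (λ o D f s → (o :+ D) :* f :+ (o :+ (o :+ D)) :* s
                := D :* (f :+ s) :+ (o :* s :+ o :* (f :+ s))) refl 1# (D x y) (f y) (s y))
             (+-congˡ (+-cong (*-identityˡ (s y)) (*-identityˡ (F y))))) ⟩
      ∑ ℝ G (λ y → D x y * F y + (s y + F y))
        ≈⟨ trans (∑-+ G (λ y → D x y * F y) (λ y → s y + F y)) (+-congˡ (∑-+ G s F)) ⟩
      DF x + (T + ∑ ℝ G F)
        ≈⟨ +-congˡ (trans (+-congˡ (trans ∑F≈S+T S+T≈0)) (+-identityʳ T)) ⟩
      DF x + T ∎
      where u = inj₂ (x , i)

    -- After the correction each row depends only on the base point, so pairing with φ collects the
    -- coefficients f x + s x = F x. The constant T is then multiplied by the sum of F and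
    -- disappears.
    corona-form : ∑ ℝ G F ≈ 0# →
      inner ℝ (G ⊙ H) φ (apply ℝ (G ⊙ H) D⊙ φ) + leaf-energy ≈ inner ℝ G F DF
    corona-form ∑F≈0 = begin
      inner ℝ (G ⊙ H) φ D⊙φ + leaf-energy
        ≈⟨ +-congʳ (∑-⊙ G H (λ u → φ u * D⊙φ u)) ⟩
      ∑ ℝ G (λ x → f x * D⊙φ (inj₁ x))
        + ∑ ℝ G (λ x → ∑ ℝ H (λ i → g x i * D⊙φ (inj₂ (x , i)))) + leaf-energy
        ≈⟨ +-assoc _ _ _ ⟩
      ∑ ℝ G (λ x → f x * D⊙φ (inj₁ x))
        + (∑ ℝ G (λ x → ∑ ℝ H (λ i → g x i * D⊙φ (inj₂ (x , i)))) + leaf-energy)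
        ≈⟨ +-cong
             (∑-cong G λ x → *-congˡ {f x} (core-row x))
             (trans (sym (∑-+ G (λ x → ∑ ℝ H (λ i → g x i * D⊙φ (inj₂ (x , i))))
                          (λ x → ∑ ℝ H (λ i → g x i * leaf-term (g x) i))))
               (∑-cong G λ x → trans
                 (sym (∑-+ H (λ i → g x i * D⊙φ (inj₂ (x , i))) (λ i → g x i * leaf-term (g x) i)))
                 (trans
                   (∑-cong H λ i → trans (sym (distribˡ (g x i) (D⊙φ (inj₂ (x , i))) (leaf-term (g x) i)))
                                         (*-congˡ {g x i} (leaf-row S+T≈0 x i)))
                   (∑-*ʳ H (DF x + T) (g x))))) ⟩
      ∑ ℝ G (λ x → f x * (DF x + T)) + ∑ ℝ G (λ x → s x * (DF x + T))
        ≈⟨ ∑-+ G (λ x → f x * (DF x + T)) (λ x → s x * (DF x + T)) ⟨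
      ∑ ℝ G (λ x → f x * (DF x + T) + s x * (DF x + T))
        ≈⟨ ∑-cong G (λ x → solve 4 (λ f s d t → f :* (d :+ t) :+ s :* (d :+ t)
             := (f :+ s) :* d :+ (f :+ s) :* t) refl (f x) (s x) (DF x) T) ⟩
      ∑ ℝ G (λ x → F x * DF x + F x * T)
        ≈⟨ trans (∑-+ G (λ x → F x * DF x) (λ x → F x * T)) (+-congˡ (∑-*ʳ G T F)) ⟩
      inner ℝ G F DF + ∑ ℝ G F * T
        ≈⟨ +-congˡ (trans (*-congʳ ∑F≈0) (zeroˡ T)) ⟩
      inner ℝ G F DF + 0#
        ≈⟨ +-identityʳ _ ⟩
      inner ℝ G F DF ∎
      where
      D⊙φ = apply ℝ (G ⊙ H) D⊙ φ
      S+T≈0 : S + T ≈ 0#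
      S+T≈0 = trans (sym ∑F≈S+T) ∑F≈0

-- The larger root Λ and the singular 2×2 form

module LargerRoot {ℓ} (ℝ : CompleteOrderedField ℓ) where
  open OrderedField ℝ
  open import Algebra.Properties.Group +-group using (x∙y⁻¹≈ε⇒x≈y)
  open import Relation.Binary.Reasoning.Setoid setoid

  module _ {m ν c q : Carrier} (m≈ν+1 : m ≈ ν + 1#) (0≤ν : 0# ≤ ν) where
    private
      b disc : Carrier
      b    = m * q - c
      disc = b * b + fromℕ 4 * c * q

    ν*-as-difference : ∀ x → ν * x ≈ m * x - x
    ν*-as-difference x = begin
      ν * x                  ≈⟨ solve 3 (λ ν x o → ν :* x := (ν :+ o) :* x :- o :* x) refl ν x 1# ⟩
      (ν + 1#) * x - 1# * x  ≈⟨ +-cong (*-congʳ (sym m≈ν+1)) (-‿cong (*-identityˡ x)) ⟩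
      m * x - x              ∎

    -- Let p(x) = x² - bx - cq be the polynomial with root Λ. Since 4p(x) = (2x - b)² - disc, this
    -- is the evaluation p(q) = -νq². Its sign shows both that the roots are real and that q lies
    -- between them.
    disc-minus-square : fromℕ 4 * (ν * (q * q)) ≈ disc - (fromℕ 2 * q - b) * (fromℕ 2 * q - b)
    disc-minus-square = trans (*-congˡ (ν*-as-difference (q * q)))
      (solve 3 (λ m c q → let b = m :* q :- c in
         con (+ 4) :* (m :* (q :* q) :- q :* q)
         := b :* b :+ con (+ 4) :* c :* q :- (con (+ 2) :* q :- b) :* (con (+ 2) :* q :- b)) refl m c q)

    disc-nonNeg : 0# ≤ disc
    disc-nonNeg = ≤.trans (square-nonNeg (fromℕ 2 * q - b)) (nonNeg⇒≤ (nonNeg-resp disc-minus-square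
      (*-nonNeg (fromℕ-nonNeg 4) (*-nonNeg 0≤ν (square-nonNeg q)))))

    Λ : Carrier
    Λ = 1# / fromℕ 2 * (b + √ disc)

    private
      r : Carrier
      r = √ disc

      0≤r : 0# ≤ r
      0≤r = proj₁ (√-nonNeg×square disc-nonNeg)

      rr≈disc : r * r ≈ disc
      rr≈disc = proj₂ (√-nonNeg×square disc-nonNeg)

      r≈2Λ-b : r ≈ fromℕ 2 * Λ - b
      r≈2Λ-b = sym (begin
        fromℕ 2 * (1# * fromℕ 2 ⁻¹ * (b + r)) - b
          ≈⟨ solve 5 (λ t o i b r → t :* (o :* i :* (b :+ r)) :- b := o :* (t :* i) :* (b :+ r) :- b)
               refl (fromℕ 2) 1# (fromℕ 2 ⁻¹) b r ⟩
        1# * (fromℕ 2 * fromℕ 2 ⁻¹) * (b + r) - b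
          ≈⟨ +-congʳ (*-congʳ (trans (*-identityˡ _) (⁻¹-inverse (fromℕ 2) (<⇒≉ (fromℕ-pos 1))))) ⟩
        1# * (b + r) - b
          ≈⟨ +-congʳ (*-identityˡ _) ⟩
        b + r - b
          ≈⟨ solve 2 (λ b r → b :+ r :- b := r) refl b r ⟩
        r ∎)

    root : Λ * Λ + c * Λ ≈ q * (m * Λ + c)
    root = x∙y⁻¹≈ε⇒x≈y _ _ (*-cancelˡ-≈0 (<⇒≉ (fromℕ-pos 3)) (begin
      fromℕ 4 * (Λ * Λ + c * Λ - q * (m * Λ + c))
        ≈⟨ solve 4 (λ m c q x → let b = m :* q :- c in
             con (+ 4) :* (x :* x :+ c :* x :- q :* (m :* x :+ c))
             := (con (+ 2) :* x :- b) :* (con (+ 2) :* x :- b) :- (b :* b :+ con (+ 4) :* c :* q)) refl m c q Λ ⟩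
      (fromℕ 2 * Λ - b) * (fromℕ 2 * Λ - b) - disc
        ≈⟨ +-congʳ (*-cong r≈2Λ-b r≈2Λ-b) ⟨
      r * r - disc
        ≈⟨ +-congʳ rr≈disc ⟩
      disc - disc
        ≈⟨ -‿inverseʳ disc ⟩
      0# ∎))

    q≤Λ : q ≤ Λ
    q≤Λ = nonNeg⇒≤ (*-cancelˡ-nonNeg (fromℕ-pos 1) (nonNeg-resp (begin
      r - (fromℕ 2 * q - b)
        ≈⟨ +-congʳ r≈2Λ-b ⟩
      fromℕ 2 * Λ - b - (fromℕ 2 * q - b)
        ≈⟨ solve 3 (λ x b q → con (+ 2) :* x :- b :- (con (+ 2) :* q :- b) := con (+ 2) :* (x :- q)) refl Λ b q ⟩
      fromℕ 2 * (Λ - q) ∎)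
      (≤⇒nonNeg (square-cancel-≤ 0≤r (nonNeg⇒≤ (nonNeg-resp (begin
        fromℕ 4 * (ν * (q * q))
          ≈⟨ disc-minus-square ⟩
        disc - (fromℕ 2 * q - b) * (fromℕ 2 * q - b)
          ≈⟨ +-congʳ rr≈disc ⟨
        r * r - (fromℕ 2 * q - b) * (fromℕ 2 * q - b) ∎)
        (*-nonNeg (fromℕ-nonNeg 4) (*-nonNeg 0≤ν (square-nonNeg q)))))))))

    -- The same polynomial has p(-c/m) = -νc²/m² ≤ 0, so -c/m does not exceed the larger root.
    -- Everything is multiplied by m, and by m² after squaring, to stay free of division.
    0≤mΛ+c : 0# ≤ m * Λ + c
    0≤mΛ+c = *-cancelˡ-nonNeg (fromℕ-pos 1) (nonNeg-resp (begin
      m * r - - (fromℕ 2 * c + m * b)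
        ≈⟨ +-congʳ (*-congˡ r≈2Λ-b) ⟩
      m * (fromℕ 2 * Λ - b) - - (fromℕ 2 * c + m * b)
        ≈⟨ solve 4 (λ m x b c → m :* (con (+ 2) :* x :- b) :- :- (con (+ 2) :* c :+ m :* b)
             := con (+ 2) :* (m :* x :+ c)) refl m Λ b c ⟩
      fromℕ 2 * (m * Λ + c) ∎)
      (≤⇒nonNeg (square-cancel-≤ (*-nonNeg 0≤m 0≤r) (nonNeg⇒≤ (nonNeg-resp (begin
        fromℕ 4 * (ν * (c * c))
          ≈⟨ *-congˡ (ν*-as-difference (c * c)) ⟩
        fromℕ 4 * (m * (c * c) - c * c)
          ≈⟨ solve 3 (λ m c q → let b = m :* q :- c; y = :- (con (+ 2) :* c :+ m :* b) in
               con (+ 4) :* (m :* (c :* c) :- c :* c)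
               := m :* m :* (b :* b :+ con (+ 4) :* c :* q) :- y :* y) refl m c q ⟩
        m * m * disc - - (fromℕ 2 * c + m * b) * - (fromℕ 2 * c + m * b)
          ≈⟨ +-congʳ (trans (*-congˡ (sym rr≈disc))
               (solve 2 (λ m r → m :* m :* (r :* r) := m :* r :* (m :* r)) refl m r)) ⟩
        m * r * (m * r) - - (fromℕ 2 * c + m * b) * - (fromℕ 2 * c + m * b) ∎)
        (*-nonNeg (fromℕ-nonNeg 4) (*-nonNeg 0≤ν (square-nonNeg c))))))))
      where
      0≤m : 0# ≤ m
      0≤m = nonNeg-resp (sym m≈ν+1) (+-nonNeg 0≤ν 0≤1)

  -- The 2×2 form in (f , s) is singular exactly because Λ is a root, so Λ - q
  -- times it is a square.
  singular-form : ∀ {m ν c q Λ} → m ≈ ν + 1# → 0# < ν → 0# ≤ c →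
    Λ * Λ + c * Λ ≈ q * (m * Λ + c) → q ≤ Λ →
    ∀ f s → 0# ≤ ν * Λ * (f * f) + (Λ + c) * (s * s) - ν * q * ((f + s) * (f + s))
  singular-form {m} {ν} {c} {q} {Λ} m≈ν+1 0<ν 0≤c root q≤Λ f s with Λ - q ≤.≟ 0#
  ... | no Λ-q≉0 = *-cancelˡ-nonNeg (λ Λ-q≤0 → Λ-q≉0 (≤.antisym Λ-q≤0 (≤⇒nonNeg q≤Λ)))
    (nonNeg-resp (begin
      ν * (y * y)
        ≈⟨ trans (sym (+-identityʳ _)) (+-congˡ (sym (trans (*-congʳ det≈0) (zeroˡ (s * s))))) ⟩
      ν * (y * y) + (Λ * Λ + c * Λ - q * (ν * Λ + Λ + c)) * (s * s)
        ≈⟨ solve 6 (λ ν c q x f s → let y = (x :- q) :* f :- q :* s in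
             ν :* (y :* y) :+ (x :* x :+ c :* x :- q :* (ν :* x :+ x :+ c)) :* (s :* s)
             := (x :- q) :* (ν :* x :* (f :* f) :+ (x :+ c) :* (s :* s) :- ν :* q :* ((f :+ s) :* (f :+ s))))
             refl ν c q Λ f s ⟩
      (Λ - q) * (ν * Λ * (f * f) + (Λ + c) * (s * s) - ν * q * ((f + s) * (f + s))) ∎)
      (*-nonNeg (<⇒≤ 0<ν) (square-nonNeg y)))
    where
    -- Completing the square with pivot ν(Λ - q): νy is the first row of the form applied to (f ,
    -- s), and the remaining coefficient of s² is the determinant over ν, zero by the root equation.
    y = (Λ - q) * f - q * s
    det≈0 : Λ * Λ + c * Λ - q * (ν * Λ + Λ + c) ≈ 0#
    det≈0 = begin
      Λ * Λ + c * Λ - q * (ν * Λ + Λ + c)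
        ≈⟨ +-congˡ (-‿cong (*-congˡ (+-congʳ (trans (+-congˡ (sym (*-identityˡ Λ)))
             (trans (sym (distribʳ Λ ν 1#)) (*-congʳ (sym m≈ν+1))))))) ⟩
      Λ * Λ + c * Λ - q * (m * Λ + c)
        ≈⟨ +-congʳ root ⟩
      q * (m * Λ + c) - q * (m * Λ + c)
        ≈⟨ -‿inverseʳ _ ⟩
      0# ∎
  -- Here Λ - q cannot be cancelled. But the root equation at Λ = q reads νq² = 0, so q = Λ = 0 and
  -- the form reduces to cs².
  ... | yes Λ-q≈0 = nonNeg-resp (begin
      c * (s * s)
        ≈⟨ solve 4 (λ ν c f s → c :* (s :* s)
             := ν :* con (+ 0) :* (f :* f) :+ (con (+ 0) :+ c) :* (s :* s)
                :- ν :* con (+ 0) :* ((f :+ s) :* (f :+ s))) refl ν c f s ⟩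
      ν * 0# * (f * f) + (0# + c) * (s * s) - ν * 0# * ((f + s) * (f + s))
        ≈⟨ +-cong (+-cong (*-congʳ (*-congˡ Λ≈0)) (*-congʳ (+-congʳ Λ≈0)))
             (-‿cong (*-congʳ (*-congˡ q≈0))) ⟨
      ν * Λ * (f * f) + (Λ + c) * (s * s) - ν * q * ((f + s) * (f + s)) ∎)
      (*-nonNeg 0≤c (square-nonNeg s))
    where
    Λ≈q : Λ ≈ q
    Λ≈q = x∙y⁻¹≈ε⇒x≈y _ _ Λ-q≈0
    q≈0 : q ≈ 0#
    q≈0 = square≈0 (*-cancelˡ-≈0 (<⇒≉ 0<ν) (begin
      ν * (q * q)
        ≈⟨ solve 4 (λ ν c q o → ν :* (q :* q)
             := q :* ((ν :+ o) :* q :+ c) :- (o :* (q :* q) :+ c :* q)) refl ν c q 1# ⟩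
      q * ((ν + 1#) * q + c) - (1# * (q * q) + c * q)
        ≈⟨ +-cong (*-congˡ (+-congʳ (*-congʳ (sym m≈ν+1)))) (-‿cong (+-congʳ (*-identityˡ _))) ⟩
      q * (m * q + c) - (q * q + c * q)
        ≈⟨ +-cong (*-congˡ (+-congʳ (*-congˡ Λ≈q))) (-‿cong (+-cong (*-cong Λ≈q Λ≈q) (*-congˡ Λ≈q))) ⟨
      q * (m * Λ + c) - (Λ * Λ + c * Λ)
        ≈⟨ +-congˡ (-‿cong root) ⟩
      q * (m * Λ + c) - q * (m * Λ + c)
        ≈⟨ -‿inverseʳ _ ⟩
      0# ∎))
    Λ≈0 : Λ ≈ 0#
    Λ≈0 = trans Λ≈q q≈0

-- Constrained maxima and the adjacency form

module GraphForms {ℓ} (ℝ : CompleteOrderedField ℓ) where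
  open FiniteSums ℝ
  open GraphSums ℝ
  open SymmetricMatrices ℝ using (SquareMatrix; quad; _∙_; rayleigh-bound)
  open import Relation.Binary.Reasoning.Setoid setoid

  module _ (G : Graph) where
    open Graph G using (V; vertex)

    inner-cong : {u u′ v v′ : V → Carrier} → (∀ x → u x ≈ u′ x) → (∀ x → v x ≈ v′ x) →
                 inner ℝ G u v ≈ inner ℝ G u′ v′
    inner-cong u≈u′ v≈v′ = ∑-cong G λ x → *-cong (u≈u′ x) (v≈v′ x)

    inner-scale : ∀ c d (u v : V → Carrier) →
      inner ℝ G (λ x → c * u x) (λ x → d * v x) ≈ c * d * inner ℝ G u v
    inner-scale c d u v = trans
      (∑-cong G λ x → solve 4 (λ c d u v → c :* u :* (d :* v) := c :* d :* (u :* v)) refl c d (u x) (v x))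
      (∑-*ˡ G (c * d) (λ x → u x * v x))

    mean-scale : ∀ c (u : V → Carrier) → inner ℝ G (𝟏 ℝ G) u ≈ 0# → inner ℝ G (𝟏 ℝ G) (λ x → c * u x) ≈ 0#
    mean-scale c u mean≈0 = begin
      ∑ ℝ G (λ x → 1# * (c * u x))  ≈⟨ ∑-cong G (λ x → solve 3 (λ o c u → o :* (c :* u) := c :* (o :* u)) refl 1# c (u x)) ⟩
      ∑ ℝ G (λ x → c * (1# * u x))  ≈⟨ ∑-*ˡ G c (λ x → 1# * u x) ⟩
      c * inner ℝ G (𝟏 ℝ G) u       ≈⟨ *-congˡ mean≈0 ⟩
      c * 0#                        ≈⟨ zeroʳ c ⟩
      0#                            ∎

    apply-scale : ∀ M c (u : V → Carrier) x → apply ℝ G M (λ y → c * u y) x ≈ c * apply ℝ G M u x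
    apply-scale M c u x = trans
      (∑-cong G λ y → solve 3 (λ m c u → m :* (c :* u) := c :* (m :* u)) refl (M x y) c (u y))
      (∑-*ˡ G c (λ y → M x y * u y))

    form-scale : ∀ M c (u : V → Carrier) →
      inner ℝ G (λ x → c * u x) (apply ℝ G M (λ x → c * u x)) ≈ c * c * inner ℝ G u (apply ℝ G M u)
    form-scale M c u = trans
      (inner-cong {v = apply ℝ G M (λ x → c * u x)} (λ x → refl {c * u x}) (apply-scale M c u))
      (inner-scale c c u (apply ℝ G M u))

    norm²≥0 : ∀ (u : V → Carrier) → 0# ≤ inner ℝ G u u
    norm²≥0 u = sum-nonNeg (λ i → square-nonNeg (u (vertex i)))

    module _ (M : Matrix ℝ G) where
      ConstrainedValue : Pred Carrier ℓ
      ConstrainedValue t = ∃[ f ] (inner ℝ G f f ≈ 1#) × (inner ℝ G (𝟏 ℝ G) f ≈ 0#) ×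
                                  (t ≈ inner ℝ G f (apply ℝ G M f))

      normalised-value : ∀ u → 0# < inner ℝ G u u → inner ℝ G (𝟏 ℝ G) u ≈ 0# →
        ConstrainedValue (inner ℝ G u u ⁻¹ * inner ℝ G u (apply ℝ G M u))
      normalised-value u 0<N mean≈0 = (λ x → i * u x) , unit , mean-scale i u mean≈0 , value
        where
        N = inner ℝ G u u
        r = √ N
        i = r ⁻¹
        rr≈N : r * r ≈ N
        rr≈N = proj₂ (√-nonNeg×square (<⇒≤ 0<N))
        r≉0 : ¬ r ≈ 0#
        r≉0 r≈0 = <⇒≉ 0<N (trans (sym rr≈N) (trans (*-congʳ r≈0) (zeroˡ r)))
        iiN≈1 : i * i * N ≈ 1#
        iiN≈1 = begin
          i * i * N          ≈⟨ *-congˡ rr≈N ⟨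
          i * i * (r * r)    ≈⟨ solve 2 (λ i r → i :* i :* (r :* r) := r :* i :* (r :* i)) refl i r ⟩
          r * i * (r * i)    ≈⟨ *-cong (⁻¹-inverse r r≉0) (⁻¹-inverse r r≉0) ⟩
          1# * 1#            ≈⟨ *-identityˡ 1# ⟩
          1#                 ∎
        N⁻¹≈ii : N ⁻¹ ≈ i * i
        N⁻¹≈ii = begin
          N ⁻¹               ≈⟨ *-identityˡ _ ⟨
          1# * N ⁻¹          ≈⟨ *-congʳ iiN≈1 ⟨
          i * i * N * N ⁻¹   ≈⟨ *-assoc _ _ _ ⟩
          i * i * (N * N ⁻¹) ≈⟨ *-congˡ (⁻¹-inverse N (<⇒≉ 0<N)) ⟩
          i * i * 1#         ≈⟨ *-identityʳ _ ⟩
          i * i              ∎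
        unit : inner ℝ G (λ x → i * u x) (λ x → i * u x) ≈ 1#
        unit = trans (inner-scale i i u u) iiN≈1
        value : N ⁻¹ * inner ℝ G u (apply ℝ G M u) ≈ inner ℝ G (λ x → i * u x) (apply ℝ G M (λ x → i * u x))
        value = trans (*-congʳ N⁻¹≈ii) (sym (form-scale M i u))

      -- Both sides scale quadratically, so the bound on unit vectors extends to all vectors of sum
      -- 0. A vector of norm 0 cannot be normalised, but then all its entries vanish and both sides
      -- are 0.
      maximum-bounds-form : ∀ {q} → IsMaximum ConstrainedValue q → ∀ u → inner ℝ G (𝟏 ℝ G) u ≈ 0# →
        inner ℝ G u (apply ℝ G M u) ≤ q * inner ℝ G u u
      maximum-bounds-form {q} (_ , upper) u mean≈0 with inner ℝ G u u ≤.≤? 0#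
      ... | yes N≤0 = ≤.reflexive (trans
              (sum-≈0 λ i → trans (*-congʳ (u≈0 i)) (zeroˡ (apply ℝ G M u (vertex i))))
              (sym (trans (*-congˡ N≈0) (zeroʳ q))))
        where
        N≈0 : inner ℝ G u u ≈ 0#
        N≈0 = ≤.antisym N≤0 (norm²≥0 u)
        u≈0 : ∀ i → u (vertex i) ≈ 0#
        u≈0 i = square≈0 (sum-nonNeg-≈0 (λ j → square-nonNeg (u (vertex j))) N≈0 i)
      ... | no 0<N = nonNeg⇒≤ (nonNeg-resp (begin
              N * (q - N ⁻¹ * W)       ≈⟨ solve 4 (λ N q j W → N :* (q :- j :* W) := q :* N :- N :* j :* W) refl N q (N ⁻¹) W ⟩
              q * N - N * N ⁻¹ * W     ≈⟨ +-congˡ (-‿cong (trans (*-congʳ (⁻¹-inverse N (<⇒≉ 0<N))) (*-identityˡ W))) ⟩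
              q * N - W                ∎)
              (*-nonNeg (<⇒≤ 0<N) (≤⇒nonNeg (upper _ (normalised-value u 0<N mean≈0)))))
        where
        N = inner ℝ G u u
        W = inner ℝ G u (apply ℝ G M u)

      -- Allows a maximiser to be exhibited only up to scale.
      eigenvalue-value : ∀ {t} u → 0# < inner ℝ G u u → inner ℝ G (𝟏 ℝ G) u ≈ 0# →
        inner ℝ G u (apply ℝ G M u) ≈ t * inner ℝ G u u → ConstrainedValue t
      eigenvalue-value {t} u 0<N mean≈0 W≈tN =
        let f , unit , mean , value = normalised-value u 0<N mean≈0
        in f , unit , mean , trans (begin
          t                  ≈⟨ *-identityʳ t ⟨
          t * 1#             ≈⟨ *-congˡ (⁻¹-inverse N (<⇒≉ 0<N)) ⟨
          t * (N * N ⁻¹)     ≈⟨ solve 3 (λ t N j → t :* (N :* j) := j :* (t :* N)) refl t N (N ⁻¹) ⟩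
          N ⁻¹ * (t * N)     ≈⟨ *-congˡ W≈tN ⟨
          N ⁻¹ * inner ℝ G u (apply ℝ G M u) ∎) value
        where N = inner ℝ G u u

  module Adjacency (H : Graph) where
    open Graph H using (V; vertex; V↔Fin; ∣V∣; _~?_)

    A : Matrix ℝ H
    A = adjacencyMatrix ℝ H

    entry-bound : ∀ i j x y → 0# ≤ x * (A i j * y) + (x * x + y * y)
    entry-bound i j x y with i ~? j
    ... | no _ = nonNeg-resp
      (solve 2 (λ x y → x :* x :+ y :* y := x :* (con (+ 0) :* y) :+ (x :* x :+ y :* y)) refl x y)
      (+-nonNeg (square-nonNeg x) (square-nonNeg y))
    ... | yes _ = nonNeg-resp (+-congʳ (*-congˡ (sym (*-identityˡ y))))
      (*-cancelˡ-nonNeg (fromℕ-pos 1) (nonNeg-resp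
        (solve 2 (λ x y → x :* x :+ y :* y :+ (x :+ y) :* (x :+ y)
           := con (+ 2) :* (x :* y :+ (x :* x :+ y :* y))) refl x y)
        (+-nonNeg (+-nonNeg (square-nonNeg x) (square-nonNeg y)) (square-nonNeg (x + y)))))

    A-fin : SquareMatrix ∣V∣
    A-fin i j = A (vertex i) (vertex j)

    -- Supplies the upper bound without which the supremum in `rayleigh-bound` need not exist; its
    -- size is irrelevant. Summing `entry-bound` over all ordered pairs counts each square 2∣V∣
    -- times.
    quad-bound : ∀ v → 0# ≤ quad A-fin v + (fromℕ ∣V∣ + fromℕ ∣V∣) * (v ∙ v)
    quad-bound v = nonNeg-resp (begin
      sumFin (λ i → sumFin (λ j → v i * (A-fin i j * v j) + (v i * v i + v j * v j)))
        ≈⟨ sum-cong (λ i → row i) ⟩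
      sumFin (λ i → v i * (A-fin i ∙ v) + (N * (v i * v i) + v ∙ v))
        ≈⟨ ∑-distrib-+ (λ i → v i * (A-fin i ∙ v)) (λ i → N * (v i * v i) + v ∙ v) ⟩
      quad A-fin v + sumFin (λ i → N * (v i * v i) + v ∙ v)
        ≈⟨ +-congˡ (trans (∑-distrib-+ (λ i → N * (v i * v i)) (λ i → v ∙ v))
             (+-cong (sym (*-distribˡ-sum N (λ i → v i * v i))) (sum-const ∣V∣ (v ∙ v)))) ⟩
      quad A-fin v + (N * (v ∙ v) + N * (v ∙ v))
        ≈⟨ +-congˡ (distribʳ (v ∙ v) N N) ⟨
      quad A-fin v + (N + N) * (v ∙ v) ∎)
      (sum-nonNeg λ i → sum-nonNeg λ j → entry-bound (vertex i) (vertex j) (v i) (v j))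
      where
      N = fromℕ ∣V∣
      row : ∀ i → sumFin (λ j → v i * (A-fin i j * v j) + (v i * v i + v j * v j))
                  ≈ v i * (A-fin i ∙ v) + (N * (v i * v i) + v ∙ v)
      row i = trans
        (∑-distrib-+ (λ j → v i * (A-fin i j * v j)) (λ j → v i * v i + v j * v j))
        (+-cong (sym (*-distribˡ-sum (v i) (λ j → A-fin i j * v j)))
          (trans (∑-distrib-+ (λ j → v i * v i) (λ j → v j * v j))
            (+-congʳ (sum-const ∣V∣ (v i * v i)))))

    least-eigenvalue-bound : ∀ {μ} → IsMinimum (ev ℝ H A) μ →
      ∀ (h : V → Carrier) → 0# ≤ inner ℝ H h (apply ℝ H A h) + - μ * inner ℝ H h h
    least-eigenvalue-bound {μ} (_ , lower) h = rayleigh-bound A-fin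
      (λ i j → adjacency-sym H (vertex i) (vertex j)) (_ , quad-bound) μ
      (λ t v (i , vi≉0) Av≈tv → lower t
        ( v ∘ index
        , (vertex i , λ v≈0 → vi≉0 (trans (reflexive (≡.cong v (≡.sym (to∘vertex H i)))) v≈0))
        , λ x → trans
            (sum-cong λ k → *-cong (reflexive (≡.cong (λ y → A y (vertex k)) (≡.sym (vertex∘to H x))))
                                   (reflexive (≡.cong v (to∘vertex H k))))
            (Av≈tv (index x))))
      (h ∘ vertex)
      where
      index = Inverse.to V↔Fin

    module _ {κ} (regular : Regular κ H) where
      private
        n K : Carrier
        n = fromℕ ∣V∣
        K = fromℕ κ

      apply-const : ∀ a i → apply ℝ H A (λ _ → a) i ≈ K * a
      apply-const a i = trans (∑-*ʳ H a (A i)) (*-congʳ (regular-row-sum κ H regular i))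

      ∑-apply : ∀ (g : V → Carrier) → ∑ ℝ H (apply ℝ H A g) ≈ K * ∑ ℝ H g
      ∑-apply g = begin
        ∑ ℝ H (λ i → ∑ ℝ H (λ j → A i j * g j))
          ≈⟨ ∑-comm (λ i j → A (vertex i) (vertex j) * g (vertex j)) ⟩
        ∑ ℝ H (λ j → ∑ ℝ H (λ i → A i j * g j))
          ≈⟨ ∑-cong H (λ j → trans (∑-*ʳ H (g j) (λ i → A i j)) (*-congʳ (trans
               (∑-cong H (λ i → adjacency-sym H i j)) (regular-row-sum κ H regular j)))) ⟩
        ∑ ℝ H (λ j → K * g j)
          ≈⟨ ∑-*ˡ H K g ⟩
        K * ∑ ℝ H g ∎

      -- The bound on all of C(V), applied to n g - s 𝟏 ⊥ 𝟏.
      restricted-bound : 0# < n → ∀ b →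
        (∀ (h : V → Carrier) → 0# ≤ inner ℝ H h (apply ℝ H A h) + b * inner ℝ H h h) →
        ∀ (g : V → Carrier) → let s = ∑ ℝ H g in
        0# ≤ n * (inner ℝ H g (apply ℝ H A g) + b * inner ℝ H g g) - (b + K) * (s * s)
      restricted-bound 0<n b bound g = *-cancelˡ-nonNeg 0<n (nonNeg-resp (begin
        inner ℝ H h (apply ℝ H A h) + b * inner ℝ H h h
          ≈⟨ +-cong form-h (*-congˡ norm-h) ⟩
        n * n * Q - n * K * (s * s) + b * (n * n * N - n * (s * s))
          ≈⟨ solve 6 (λ n K s Q b N →
               n :* n :* Q :- n :* K :* (s :* s) :+ b :* (n :* n :* N :- n :* (s :* s))
               := n :* (n :* (Q :+ b :* N) :- (b :+ K) :* (s :* s))) refl n K s Q b N ⟩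
        n * (n * (Q + b * N) - (b + K) * (s * s)) ∎) (bound h))
        where
        s = ∑ ℝ H g
        Ag = apply ℝ H A g
        Q = inner ℝ H g Ag
        N = inner ℝ H g g
        h : V → Carrier
        h i = n * g i + - s
        Ah : ∀ i → apply ℝ H A h i ≈ n * Ag i + K * - s
        Ah i = begin
          ∑ ℝ H (λ j → A i j * (n * g j + - s))
            ≈⟨ ∑-cong H (λ j → distribˡ (A i j) (n * g j) (- s)) ⟩
          ∑ ℝ H (λ j → A i j * (n * g j) + A i j * - s)
            ≈⟨ ∑-+ H (λ j → A i j * (n * g j)) (λ j → A i j * - s) ⟩
          apply ℝ H A (λ j → n * g j) i + apply ℝ H A (λ _ → - s) i
            ≈⟨ +-cong (apply-scale H A n g i) (apply-const (- s) i) ⟩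
          n * Ag i + K * - s ∎
        form-h : inner ℝ H h (apply ℝ H A h) ≈ n * n * Q - n * K * (s * s)
        form-h = begin
          ∑ ℝ H (λ i → h i * apply ℝ H A h i)
            ≈⟨ ∑-cong H (λ i → trans (*-congˡ (Ah i))
                 (solve 5 (λ n K s g a → (n :* g :+ :- s) :* (n :* a :+ K :* :- s)
                    := n :* n :* (g :* a) :+ (:- (n :* K :* s) :* g :+ (:- (s :* n) :* a :+ s :* K :* s)))
                    refl n K s (g i) (Ag i))) ⟩
          ∑ ℝ H (λ i → n * n * (g i * Ag i) + (- (n * K * s) * g i + (- (s * n) * Ag i + s * K * s)))
            ≈⟨ ∑-+ H (λ i → n * n * (g i * Ag i)) (λ i → - (n * K * s) * g i + (- (s * n) * Ag i + s * K * s)) ⟩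
          ∑ ℝ H (λ i → n * n * (g i * Ag i)) + ∑ ℝ H (λ i → - (n * K * s) * g i + (- (s * n) * Ag i + s * K * s))
            ≈⟨ +-cong (∑-*ˡ H (n * n) (λ i → g i * Ag i)) (∑-+ H (λ i → - (n * K * s) * g i) (λ i → - (s * n) * Ag i + s * K * s)) ⟩
          n * n * Q + (∑ ℝ H (λ i → - (n * K * s) * g i) + ∑ ℝ H (λ i → - (s * n) * Ag i + s * K * s))
            ≈⟨ +-congˡ (+-cong (∑-*ˡ H (- (n * K * s)) g) (∑-+ H (λ i → - (s * n) * Ag i) (λ i → s * K * s))) ⟩
          n * n * Q + (- (n * K * s) * s + (∑ ℝ H (λ i → - (s * n) * Ag i) + ∑ ℝ H (λ i → s * K * s)))
            ≈⟨ +-congˡ (+-congˡ (+-cong (trans (∑-*ˡ H (- (s * n)) Ag) (*-congˡ (∑-apply g))) (∑-const H (s * K * s)))) ⟩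
          n * n * Q + (- (n * K * s) * s + (- (s * n) * (K * s) + n * (s * K * s)))
            ≈⟨ solve 4 (λ n K s Q → n :* n :* Q :+ (:- (n :* K :* s) :* s :+ (:- (s :* n) :* (K :* s) :+ n :* (s :* K :* s)))
                 := n :* n :* Q :- n :* K :* (s :* s)) refl n K s Q ⟩
          n * n * Q - n * K * (s * s) ∎
        norm-h : inner ℝ H h h ≈ n * n * N - n * (s * s)
        norm-h = begin
          ∑ ℝ H (λ i → h i * h i)
            ≈⟨ ∑-cong H (λ i → solve 3 (λ n s g → (n :* g :+ :- s) :* (n :* g :+ :- s)
                 := n :* n :* (g :* g) :+ (:- (n :* s :+ n :* s) :* g :+ s :* s)) refl n s (g i)) ⟩
          ∑ ℝ H (λ i → n * n * (g i * g i) + (- (n * s + n * s) * g i + s * s))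
            ≈⟨ ∑-+ H (λ i → n * n * (g i * g i)) (λ i → - (n * s + n * s) * g i + s * s) ⟩
          ∑ ℝ H (λ i → n * n * (g i * g i)) + ∑ ℝ H (λ i → - (n * s + n * s) * g i + s * s)
            ≈⟨ +-cong (∑-*ˡ H (n * n) (λ i → g i * g i)) (∑-+ H (λ i → - (n * s + n * s) * g i) (λ i → s * s)) ⟩
          n * n * N + (∑ ℝ H (λ i → - (n * s + n * s) * g i) + ∑ ℝ H (λ i → s * s))
            ≈⟨ +-congˡ (+-cong (∑-*ˡ H (- (n * s + n * s)) g) (∑-const H (s * s))) ⟩
          n * n * N + (- (n * s + n * s) * s + n * (s * s))
            ≈⟨ solve 3 (λ n s N → n :* n :* N :+ (:- (n :* s :+ n :* s) :* s :+ n :* (s :* s))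
                 := n :* n :* N :- n :* (s :* s)) refl n s N ⟩
          n * n * N - n * (s * s) ∎

-- Upper bound and attainment for the corona

module CoronaQEC {ℓ} (ℝ : CompleteOrderedField ℓ) (G H : Graph) (conn : Graph.Connected G)
                 (κ : ℕ) (regular : Regular κ H) where
  open FiniteSums ℝ
  open GraphSums ℝ
  open GraphForms ℝ
  open Adjacency H using (restricted-bound; apply-const)
  open CoronaForm ℝ G H conn hiding (s)
  open LargerRoot ℝ using (singular-form)
  open import Algebra.Properties.Semiring.Mult semiring using (×-homo-+)
  open import Relation.Binary.Reasoning.Setoid setoid

  ν m c : Carrier
  ν = fromℕ (Graph.∣V∣ H)
  m = fromℕ (Graph.∣V∣ H ℕ.+ 1)
  c = fromℕ (κ ℕ.+ 2)

  m≈ν+1 : m ≈ ν + 1#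
  m≈ν+1 = trans (×-homo-+ 1# (Graph.∣V∣ H) 1) (+-congˡ (+-identityʳ 1#))

  c≈2+κ : c ≈ 1# + 1# + fromℕ κ
  c≈2+κ = trans (×-homo-+ 1# κ 2) (trans (+-comm _ _) (+-congʳ (+-congˡ (+-identityʳ 1#))))

  leaf-energy-expand : ∀ g → inner ℝ H g (leaf-term g) ≈ (1# + 1#) * inner ℝ H g g + inner ℝ H g (apply ℝ H A g)
  leaf-energy-expand g = begin
    ∑ ℝ H (λ i → g i * ((1# + 1#) * g i + apply ℝ H A g i))
      ≈⟨ ∑-cong H (λ i → solve 3 (λ t g a → g :* (t :* g :+ a) := t :* (g :* g) :+ g :* a)
           refl (1# + 1#) (g i) (apply ℝ H A g i)) ⟩
    ∑ ℝ H (λ i → (1# + 1#) * (g i * g i) + g i * apply ℝ H A g i)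
      ≈⟨ trans (∑-+ H (λ i → (1# + 1#) * (g i * g i)) (λ i → g i * apply ℝ H A g i))
           (+-congʳ (∑-*ˡ H (1# + 1#) (λ i → g i * g i))) ⟩
    (1# + 1#) * inner ℝ H g g + inner ℝ H g (apply ℝ H A g) ∎

  module _ {q Λ : Carrier} (0<ν : 0# < ν) (qec : IsQEC ℝ G conn q)
           (root : Λ * Λ + c * Λ ≈ q * (m * Λ + c)) where

    module _ (q≤Λ : q ≤ Λ)
             (bound : ∀ h → 0# ≤ inner ℝ H h (apply ℝ H A h) + (1# + 1# + Λ) * inner ℝ H h h) where

      -- After multiplication by ν the difference is exactly `singular-form` plus `restricted-bound`
      -- with shift b = 2 + Λ. Since c = κ + 2, the term (Λ + c)s² of the first cancels the term -(b
      -- + κ)s² of the second.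
      vertex-bound : ∀ f g → let s = ∑ ℝ H g in
        q * ((f + s) * (f + s)) ≤ inner ℝ H g (leaf-term g) + Λ * (f * f + inner ℝ H g g)
      vertex-bound f g = nonNeg⇒≤ (*-cancelˡ-nonNeg 0<ν (nonNeg-resp (begin
        (ν * Λ * (f * f) + (Λ + c) * (s * s) - ν * q * ((f + s) * (f + s)))
          + (ν * (Q + (1# + 1# + Λ) * N) - (1# + 1# + Λ + fromℕ κ) * (s * s))
          ≈⟨ +-congʳ (+-congʳ (+-congˡ (*-congʳ (+-congˡ c≈2+κ)))) ⟩
        (ν * Λ * (f * f) + (Λ + (1# + 1# + fromℕ κ)) * (s * s) - ν * q * ((f + s) * (f + s)))
          + (ν * (Q + (1# + 1# + Λ) * N) - (1# + 1# + Λ + fromℕ κ) * (s * s))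
          ≈⟨ solve 9 (λ ν x f t k s q Q N →
               (ν :* x :* (f :* f) :+ (x :+ (t :+ k)) :* (s :* s) :- ν :* q :* ((f :+ s) :* (f :+ s)))
                 :+ (ν :* (Q :+ (t :+ x) :* N) :- (t :+ x :+ k) :* (s :* s))
               := ν :* (t :* N :+ Q :+ x :* (f :* f :+ N) :- q :* ((f :+ s) :* (f :+ s))))
               refl ν Λ f (1# + 1#) (fromℕ κ) s q Q N ⟩
        ν * ((1# + 1#) * N + Q + Λ * (f * f + N) - q * ((f + s) * (f + s)))
          ≈⟨ *-congˡ (+-congʳ (+-congʳ (leaf-energy-expand g))) ⟨
        ν * (inner ℝ H g (leaf-term g) + Λ * (f * f + N) - q * ((f + s) * (f + s))) ∎)
        (+-nonNeg (singular-form m≈ν+1 0<ν (fromℕ-nonNeg (κ ℕ.+ 2)) root q≤Λ f s)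
                  (restricted-bound regular 0<ν (1# + 1# + Λ) bound g))))
        where
        s = ∑ ℝ H g
        Q = inner ℝ H g (apply ℝ H A g)
        N = inner ℝ H g g

      upper : IsUpperBound (ConstrainedValue (G ⊙ H) D⊙) Λ
      upper t (φ , unit , mean≈0 , t≈value) = nonNeg⇒≤ (nonNeg-resp (begin
        -- Λ - t splits into two slacks: that of `vertex-bound` summed over G, and that of the
        -- maximum q on G at the vector F.
        (∑ ℝ G (λ x → inner ℝ H (g φ x) (leaf-term (g φ x)) + Λ * M x) - q * inner ℝ G (F φ) (F φ))
          + (q * inner ℝ G (F φ) (F φ) - inner ℝ G (F φ) (DF φ))
          ≈⟨ solve 3 (λ a b c → a :- b :+ (b :- c) := a :- c) refl _ _ _ ⟩
        ∑ ℝ G (λ x → inner ℝ H (g φ x) (leaf-term (g φ x)) + Λ * M x) - inner ℝ G (F φ) (DF φ)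
          ≈⟨ +-cong total (-‿cong (sym (corona-form φ ∑F≈0))) ⟩
        leaf-energy φ + Λ - (inner ℝ (G ⊙ H) φ (apply ℝ (G ⊙ H) D⊙ φ) + leaf-energy φ)
          ≈⟨ solve 3 (λ e x w → e :+ x :- (w :+ e) := x :- w) refl (leaf-energy φ) Λ _ ⟩
        Λ - inner ℝ (G ⊙ H) φ (apply ℝ (G ⊙ H) D⊙ φ)
          ≈⟨ +-congˡ (-‿cong t≈value) ⟨
        Λ - t ∎)
        (+-nonNeg (≤⇒nonNeg q-bound) (≤⇒nonNeg (maximum-bounds-form G D qec (F φ) mean-F≈0))))
        where
        M : Graph.V G → Carrier
        M x = f φ x * f φ x + inner ℝ H (g φ x) (g φ x)
        ∑F≈0 : ∑ ℝ G (F φ) ≈ 0#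
        ∑F≈0 = trans (sym (mean φ)) mean≈0
        mean-F≈0 : inner ℝ G (𝟏 ℝ G) (F φ) ≈ 0#
        mean-F≈0 = trans (∑-cong G λ x → *-identityˡ (F φ x)) ∑F≈0
        total : ∑ ℝ G (λ x → inner ℝ H (g φ x) (leaf-term (g φ x)) + Λ * M x) ≈ leaf-energy φ + Λ
        total = begin
          ∑ ℝ G (λ x → inner ℝ H (g φ x) (leaf-term (g φ x)) + Λ * M x)
            ≈⟨ ∑-+ G (λ x → inner ℝ H (g φ x) (leaf-term (g φ x))) (λ x → Λ * M x) ⟩
          leaf-energy φ + ∑ ℝ G (λ x → Λ * M x)
            ≈⟨ +-congˡ (∑-*ˡ G Λ M) ⟩
          leaf-energy φ + Λ * ∑ ℝ G M
            ≈⟨ +-congˡ (trans (*-congˡ (trans (sym (norm φ)) unit)) (*-identityʳ Λ)) ⟩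
          leaf-energy φ + Λ ∎
        q-bound : q * inner ℝ G (F φ) (F φ) ≤ ∑ ℝ G (λ x → inner ℝ H (g φ x) (leaf-term (g φ x)) + Λ * M x)
        q-bound = ≤.≤-respˡ-≈ (∑-*ˡ G q (λ x → F φ x * F φ x))
          (sum-mono λ k → vertex-bound (f φ (Graph.vertex G k)) (g φ (Graph.vertex G k)))

    -- The vector makes every estimate of the upper bound tight. It is constant on each copy, so n g
    -- - s 𝟏 = 0; F is a multiple of a maximiser for G; and (f , s) = ((Λ + c)u , νΛu) is a null
    -- vector of the 2×2 form, because (Λ - q)(Λ + c) = qνΛ is the root equation.
    attained : ConstrainedValue (G ⊙ H) D⊙ Λ
    attained = attained-by (proj₁ qec)
      where
      attained-by : ConstrainedValue G D q → ConstrainedValue (G ⊙ H) D⊙ Λ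
      attained-by (u , unit , mean-u≈0 , q≈value) =
        eigenvalue-value (G ⊙ H) D⊙ φ 0<N (trans (mean φ) ∑F≈0) eigen
        where
        φ : Graph.V (G ⊙ H) → Carrier
        φ (inj₁ x)       = (Λ + c) * u x
        φ (inj₂ (x , _)) = Λ * u x
        k : Carrier
        -- Equal to mΛ + c, so the root equation takes the form kq = Λ(Λ + c).
        k = Λ + c + ν * Λ
        F≈ku : ∀ x → F φ x ≈ k * u x
        F≈ku x = begin
          (Λ + c) * u x + ∑ ℝ H (λ _ → Λ * u x)    ≈⟨ +-congˡ (∑-const H (Λ * u x)) ⟩
          (Λ + c) * u x + ν * (Λ * u x)            ≈⟨ solve 4 (λ x c ν u → (x :+ c) :* u :+ ν :* (x :* u)
                                                        := (x :+ c :+ ν :* x) :* u) refl Λ c ν (u x) ⟩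
          k * u x                                  ∎
        ∑F≈0 : ∑ ℝ G (F φ) ≈ 0#
        ∑F≈0 = begin
          ∑ ℝ G (F φ)                        ≈⟨ ∑-cong G (λ x → trans (F≈ku x) (sym (*-identityˡ _))) ⟩
          inner ℝ G (𝟏 ℝ G) (λ x → k * u x)  ≈⟨ mean-scale G k u mean-u≈0 ⟩
          0#                                 ∎
        core-form : inner ℝ G (F φ) (DF φ) ≈ k * k * q
        core-form = begin
          inner ℝ G (F φ) (DF φ)
            ≈⟨ inner-cong G F≈ku (λ x → ∑-cong G (λ y → *-congˡ {D x y} (F≈ku y))) ⟩
          inner ℝ G (λ x → k * u x) (apply ℝ G D (λ x → k * u x))
            ≈⟨ form-scale G D k u ⟩
          k * k * inner ℝ G u (apply ℝ G D u)
            ≈⟨ *-congˡ q≈value ⟨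
          k * k * q ∎
        energy : leaf-energy φ ≈ ν * (c * (Λ * Λ))
        energy = begin
          ∑ ℝ G (λ x → ∑ ℝ H (λ i → Λ * u x * leaf-term (λ _ → Λ * u x) i))
            ≈⟨ ∑-cong G (λ x → trans
                 (∑-cong H (λ i → *-congˡ (trans
                   (+-congˡ (apply-const regular (Λ * u x) i))
                   (trans (sym (distribʳ _ _ _)) (*-congʳ (sym c≈2+κ))))))
                 (trans (∑-const H (Λ * u x * (c * (Λ * u x))))
                   (solve 4 (λ ν x u c → ν :* (x :* u :* (c :* (x :* u)))
                      := ν :* (c :* (x :* x)) :* (u :* u)) refl ν Λ (u x) c))) ⟩
          ∑ ℝ G (λ x → ν * (c * (Λ * Λ)) * (u x * u x))
            ≈⟨ ∑-*ˡ G (ν * (c * (Λ * Λ))) (λ x → u x * u x) ⟩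
          ν * (c * (Λ * Λ)) * inner ℝ G u u
            ≈⟨ trans (*-congˡ unit) (*-identityʳ _) ⟩
          ν * (c * (Λ * Λ)) ∎
        N≈ : inner ℝ (G ⊙ H) φ φ ≈ (Λ + c) * (Λ + c) + ν * (Λ * Λ)
        N≈ = begin
          inner ℝ (G ⊙ H) φ φ
            ≈⟨ norm φ ⟩
          ∑ ℝ G (λ x → (Λ + c) * u x * ((Λ + c) * u x) + ∑ ℝ H (λ _ → Λ * u x * (Λ * u x)))
            ≈⟨ ∑-cong G (λ x → trans (+-congˡ (∑-const H (Λ * u x * (Λ * u x))))
                 (solve 4 (λ x c ν u → (x :+ c) :* u :* ((x :+ c) :* u) :+ ν :* (x :* u :* (x :* u))
                    := ((x :+ c) :* (x :+ c) :+ ν :* (x :* x)) :* (u :* u)) refl Λ c ν (u x))) ⟩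
          ∑ ℝ G (λ x → ((Λ + c) * (Λ + c) + ν * (Λ * Λ)) * (u x * u x))
            ≈⟨ ∑-*ˡ G ((Λ + c) * (Λ + c) + ν * (Λ * Λ)) (λ x → u x * u x) ⟩
          ((Λ + c) * (Λ + c) + ν * (Λ * Λ)) * inner ℝ G u u
            ≈⟨ trans (*-congˡ unit) (*-identityʳ _) ⟩
          (Λ + c) * (Λ + c) + ν * (Λ * Λ) ∎
        -- The norm (Λ + c)² + νΛ² vanishes only if Λ and Λ + c are both 0, which c = κ + 2 > 0
        -- excludes.
        0<N : 0# < inner ℝ (G ⊙ H) φ φ
        0<N N≤0 = <⇒≉ 0<c (begin
          c            ≈⟨ solve 2 (λ c x → c := x :+ c :- x) refl c Λ ⟩
          Λ + c - Λ    ≈⟨ +-cong Λ+c≈0 (-‿cong Λ≈0) ⟩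
          0# - 0#      ≈⟨ -‿inverseʳ 0# ⟩
          0#           ∎)
          where
          0<c : 0# < c
          0<c = ≡.subst (λ j → 0# < fromℕ j) (ℕ.+-comm 2 κ) (fromℕ-pos (suc κ))
          0≤νΛΛ : 0# ≤ ν * (Λ * Λ)
          0≤νΛΛ = *-nonNeg (<⇒≤ 0<ν) (square-nonNeg Λ)
          sum≈0 : (Λ + c) * (Λ + c) + ν * (Λ * Λ) ≈ 0#
          sum≈0 = trans (sym N≈) (≤.antisym N≤0 (norm²≥0 (G ⊙ H) φ))
          Λ+c≈0 : Λ + c ≈ 0#
          Λ+c≈0 = square≈0 (nonNeg-+≈0 (square-nonNeg (Λ + c)) 0≤νΛΛ sum≈0)
          Λ≈0 : Λ ≈ 0#
          Λ≈0 = square≈0 (*-cancelˡ-≈0 (<⇒≉ 0<ν)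
                  (nonNeg-+≈0 0≤νΛΛ (square-nonNeg (Λ + c)) (trans (+-comm _ _) sum≈0)))
        kq≈Λ[Λ+c] : k * q ≈ Λ * Λ + c * Λ
        kq≈Λ[Λ+c] = begin
          (Λ + c + ν * Λ) * q           ≈⟨ solve 4 (λ x c ν q → (x :+ c :+ ν :* x) :* q
                                             := q :* (ν :* x :+ x :+ c)) refl Λ c ν q ⟩
          q * (ν * Λ + Λ + c)           ≈⟨ *-congˡ (+-congʳ (trans (*-congʳ m≈ν+1)
                                             (trans (distribʳ Λ ν 1#) (+-congˡ (*-identityˡ Λ))))) ⟨
          q * (m * Λ + c)               ≈⟨ root ⟨
          Λ * Λ + c * Λ                 ∎
        eigen : inner ℝ (G ⊙ H) φ (apply ℝ (G ⊙ H) D⊙ φ) ≈ Λ * inner ℝ (G ⊙ H) φ φ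
        eigen = begin
          W
            ≈⟨ solve 2 (λ w e → w := w :+ e :- e) refl W (leaf-energy φ) ⟩
          W + leaf-energy φ - leaf-energy φ
            ≈⟨ +-cong (trans (corona-form φ ∑F≈0) (trans core-form
                 (trans (*-assoc k k q) (*-congˡ kq≈Λ[Λ+c])))) (-‿cong energy) ⟩
          k * (Λ * Λ + c * Λ) - ν * (c * (Λ * Λ))
            ≈⟨ solve 3 (λ x c ν → (x :+ c :+ ν :* x) :* (x :* x :+ c :* x) :- ν :* (c :* (x :* x))
                 := x :* ((x :+ c) :* (x :+ c) :+ ν :* (x :* x))) refl Λ c ν ⟩
          Λ * ((Λ + c) * (Λ + c) + ν * (Λ * Λ))
            ≈⟨ *-congˡ N≈ ⟨
          Λ * inner ℝ (G ⊙ H) φ φ ∎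
          where W = inner ℝ (G ⊙ H) φ (apply ℝ (G ⊙ H) D⊙ φ)

theorem4p14 : ∀ {ℓ} (ℝ : CompleteOrderedField ℓ) → let open CompleteOrderedField ℝ in
    (G H : Graph) (conn : Graph.Connected G) (n κ : ℕ) →
    2 ℕ.≤ Graph.∣V∣ G → n ≡ Graph.∣V∣ H → 1 ℕ.≤ n → Regular κ H →
    (qecG : Carrier) → IsQEC ℝ G conn qecG →
    (minEv : Carrier) → IsMinimum (ev ℝ H (adjacencyMatrix ℝ H)) minEv →
    ¬ ev ℝ H (adjacencyMatrix ℝ H) (- fromℕ 2 - ψ*⁻¹ ℝ n κ qecG) →
    - fromℕ 2 - minEv ≤ - (fromℕ (κ ℕ.+ 2) / fromℕ (n ℕ.+ 1)) →
    IsQEC ℝ (G ⊙ H) (⊙-connected G H conn) (ψ*⁻¹ ℝ n κ qecG)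
theorem4p14 ℝ G H conn n κ _ ≡.refl 1≤n regular q qec μ μ-least _ cond =
  attained 0<ν qec Λ-root , upper 0<ν qec Λ-root (q≤Λ m≈ν+1 (<⇒≤ 0<ν)) shifted-bound
  where
  open FiniteSums ℝ
  open GraphForms ℝ
  open Adjacency H using (A; least-eigenvalue-bound)
  open LargerRoot ℝ using (root; q≤Λ; 0≤mΛ+c)
  open CoronaQEC ℝ G H conn κ regular
  open import Relation.Binary.Reasoning.Setoid setoid

  Λ : Carrier
  Λ = ψ*⁻¹ ℝ n κ q

  0<ν : 0# < ν
  0<ν = ≡.subst (λ k → 0# < fromℕ k) (ℕ.m+[n∸m]≡n 1≤n) (fromℕ-pos (n ℕ.∸ 1))

  Λ-root : Λ * Λ + c * Λ ≈ q * (m * Λ + c)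
  Λ-root = root m≈ν+1 (<⇒≤ 0<ν)

  0<m : 0# < m
  0<m = ≡.subst (λ k → 0# < fromℕ k) (ℕ.+-comm 1 n) (fromℕ-pos n)

  0≤Λ+c/m : 0# ≤ Λ + c / m
  0≤Λ+c/m = *-cancelˡ-nonNeg 0<m (nonNeg-resp (begin
    m * Λ + c                  ≈⟨ +-congˡ (trans (sym (*-identityʳ c)) (*-congˡ (sym (⁻¹-inverse m (<⇒≉ 0<m))))) ⟩
    m * Λ + c * (m * m ⁻¹)     ≈⟨ solve 4 (λ m x c i → m :* x :+ c :* (m :* i) := m :* (x :+ c :* i)) refl m Λ c (m ⁻¹) ⟩
    m * (Λ + c / m)            ∎) (0≤mΛ+c m≈ν+1 (<⇒≤ 0<ν)))

  -- Condition (ii) chained with the position of the root: -2 - μ ≤ -c/m ≤ Λ. Raising the shift of A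
  -- from -μ to 2 + Λ therefore keeps the form nonnegative.
  -μ≤2+Λ : 0# ≤ 1# + 1# + Λ - - μ
  -μ≤2+Λ = nonNeg-resp (begin
    (Λ + c / m) + (- (c / m) - (- fromℕ 2 - μ))
      ≈⟨ +-congˡ (+-congˡ (-‿cong (+-congʳ (-‿cong (+-congˡ (+-identityʳ 1#)))))) ⟩
    (Λ + c / m) + (- (c / m) - (- (1# + 1#) - μ))
      ≈⟨ solve 4 (λ x y t μ → x :+ y :+ (:- y :- (:- t :- μ)) := t :+ x :- :- μ) refl Λ (c / m) (1# + 1#) μ ⟩
    1# + 1# + Λ - - μ ∎)
    (+-nonNeg 0≤Λ+c/m (≤⇒nonNeg cond))

  shifted-bound : ∀ h → 0# ≤ inner ℝ H h (apply ℝ H A h) + (1# + 1# + Λ) * inner ℝ H h h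
  shifted-bound h = nonNeg-resp
    (solve 4 (λ Q N t μ → Q :+ :- μ :* N :+ (t :- :- μ) :* N := Q :+ t :* N) refl
      (inner ℝ H h (apply ℝ H A h)) (inner ℝ H h h) (1# + 1# + Λ) μ)
    (+-nonNeg (least-eigenvalue-bound μ-least h) (*-nonNeg -μ≤2+Λ (norm²≥0 H h)))
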